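{- For any graph $G$, the following equalities hold: $$V_{T}(G) = V_{ESG}(G) = V_{J}(G).$$
   Context: All graphs are finite, undirected and simple. A matching is a set of pairwise nonadjacent edges; a vertex is unsaturated (unmatched) by a matching $M$ if it is not an endpoint of an edge of $M$; a maximum matching is a matching of maximum cardinality. A walk in $G$ is a sequence of vertices $v_1v_2\cdots v_k$ with $v_iv_{i+1}\in E(G)$ for all $i$; its length is its number of edges counted with repetition. A path is a walk whose vertices are all different. A walk or path is $M$-alternating if for each pair of consecutive edges exactly one belongs to $M$; it is $mm$-alternating if moreover its first and last edges belong to $M$. Let $M$ be a maximum matching of $G$. An $M$-blossom is an odd cycle of length $2k+1$ in $G$ containing exactly $k$ edges of $M$; its base is the unique vertex of the cycle that is not matched by $M$ to another vertex of the cycle. An $M$-flower consists of an $M$-blossom together with an $M$-stem: an even-length $M$-alternating path (possibly of length zero) connecting the base of the blossom to a vertex unmatched by $M$, such that the base is the only vertex shared by the blossom and the stem. An $M$-posy consists of two distinct (not necessarily disjoint) $M$-blossoms joined by an odd-length $mm$-alternating path (with respect to $M$) whose endpoints are the bases of the two blossoms. An $M$-Tposy is an $M$-posy whose connecting path is internally disjoint from the blossoms (no internal vertex of the path lies on either blossom). An $M$-Jflower consists of an $M$-blossom and an even-length $M$-alternating walk (possibly of length zero) that starts at the base of the blossom and ends at an $M$-unsaturated vertex of $G$. An $M$-Jposy consists of two (not necessarily distinct) $M$-blossoms joined by an odd-length $mm$-alternating walk (with respect to $M$) whose endpoints are the bases of the two blossoms. The vertices of a configuration are the vertices of its blossom(s)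 and of its path or walk. A flower, posy, Tposy, Jflower or Jposy of $G$ means one relative to some maximum matching $M$ of $G$. $V_{T}(G)$ is the set of vertices of $G$ contained in some flower or some Tposy of $G$; $V_{ESG}(G)$ is the set of vertices of $G$ contained in some flower or some posy of $G$; $V_{J}(G)$ is the set of vertices of $G$ contained in some Jflower or some Jposy of $G$. -}

module Defs where

open import Data.Bool using (Bool; T)
open import Data.Bool.Properties using (T?)
open import Data.Fin using (Fin)
open import Data.Fin.Properties using (_<?_)
open import Data.List using (List; []; _∷_; length; filter; head; last; allFin; cartesianProduct)
open import Data.List.Membership.Propositional using (_∈_; _∉_)
open import Data.List.Relation.Unary.Linked using (Linked)
open import Data.List.Relation.Unary.Unique.Propositional using (Unique)
open import Data.Maybe.Relation.Unary.Any using () renaming (Any to AnyMaybe)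
open import Data.Nat using (ℕ; suc; _*_; _≤_)
open import Data.Nat.Divisibility using (_∣_; _∤_)
open import Data.Product using (Σ-syntax; _×_; _,_)
open import Data.Sum using (_⊎_)
open import Function.Bundles using (_⇔_)
open import Level using (0ℓ)
open import Relation.Binary.Construct.Closure.ReflexiveTransitive using (Star; ε; _◅_)
open import Relation.Binary.Core using (Rel)
open import Relation.Binary.Definitions using (Symmetric; Irreflexive)
open import Relation.Binary.PropositionalEquality using (_≡_; _≢_)
open import Relation.Nullary using (¬_)
open import Relation.Nullary.Decidable using (_×-dec_)
open import Relation.Unary using (Pred; _∪_)

record Graph (n : ℕ) : Set where
  field
    adj : Fin n → Fin n → Bool

  Adj : Rel (Fin n) 0ℓ
  Adj u v = T (adj u v)

  field
    adj-sym    : Symmetric Adj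
    adj-irrefl : Irreflexive _≡_ Adj

module _ {n : ℕ} (G : Graph n) where
  open Graph G

  -- A set of edges is encoded as a symmetric Boolean relation on vertices.
  record Matching : Set where
    field
      mem : Fin n → Fin n → Bool

    Mem : Rel (Fin n) 0ℓ
    Mem u v = T (mem u v)

    field
      mem-sym     : Symmetric Mem
      mem⇒adj     : ∀ {u v} → Mem u v → Adj u v
      nonadjacent : ∀ {u v w} → Mem u v → Mem u w → v ≡ w

    -- Each edge is counted once, as the pair listing its smaller endpoint first.
    size : ℕ
    size = length (filter (λ (u , v) → (u <? v) ×-dec T? (mem u v))
                          (cartesianProduct (allFin n) (allFin n)))

    Unsaturated : Pred (Fin n) 0ℓ
    Unsaturated u = ∀ v → ¬ Mem u v

  Maximum : Pred Matching 0ℓ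
  Maximum M = ∀ (M′ : Matching) → Matching.size M′ ≤ Matching.size M

  Walk : Rel (Fin n) 0ℓ
  Walk = Star Adj

module _ {A : Set} {R : Rel A 0ℓ} where

  vertices : ∀ {u v} → Star R u v → List A
  vertices {u} ε       = u ∷ []
  vertices {u} (_ ◅ w) = u ∷ vertices w

  edges : ∀ {u v} → Star R u v → List (A × A)
  edges     ε                 = []
  edges {u} (_◅_ {j = v} _ w) = (u , v) ∷ edges w

  ∥_∥ : ∀ {u v} → Star R u v → ℕ
  ∥ w ∥ = length (edges w)

  IsPath : ∀ {u v} → Star R u v → Set
  IsPath w = Unique (vertices w)

module _ {n : ℕ} (G : Graph n) where
  open Graph G

  -- A cycle is presented as a path together with an edge joining its two ends,
  -- so one cycle has several presentations; they are identified by SameCycle.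
  record Cycle : Set where
    field
      {first final} : Fin n
      path          : Walk G first final
      isPath        : IsPath path
      closing       : Adj final first

    cycleVertices : List (Fin n)
    cycleVertices = vertices path

    cycleEdges : List (Fin n × Fin n)
    cycleEdges = (final , first) ∷ edges path

    field
      length≥3 : 3 ≤ length cycleEdges

    HasEdge : Rel (Fin n) 0ℓ
    HasEdge u v = (u , v) ∈ cycleEdges ⊎ (v , u) ∈ cycleEdges

module _ {n : ℕ} {G : Graph n} where

  SameCycle : Rel (Cycle G) 0ℓ
  SameCycle C D = ∀ u v → Cycle.HasEdge C u v ⇔ Cycle.HasEdge D u v

  module _ (M : Matching G) where
    open Matching M

    InM : Pred (Fin n × Fin n) 0ℓ
    InM (u , v) = Mem u v

    ExactlyOneInM : Rel (Fin n × Fin n) 0ℓ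
    ExactlyOneInM e f = (InM e × ¬ InM f) ⊎ (¬ InM e × InM f)

    Alternating : ∀ {u v} → Walk G u v → Set
    Alternating w = Linked ExactlyOneInM (edges w)

    MMAlternating : ∀ {u v} → Walk G u v → Set
    MMAlternating w =
      Alternating w × AnyMaybe InM (head (edges w)) × AnyMaybe InM (last (edges w))

    record Blossom : Set where
      field
        cycle : Cycle G
      open Cycle cycle public
      field
        k         : ℕ
        oddLength : length cycleEdges ≡ suc (2 * k)
        kMatched  : length (filter (λ (u , v) → T? (mem u v)) cycleEdges) ≡ k

      -- The length and the number of matching edges force exactly one vertex
      -- to satisfy this.
      IsBase : Pred (Fin n) 0ℓ
      IsBase b = b ∈ cycleVertices × (∀ {u} → u ∈ cycleVertices → ¬ Mem b u)

    record Flower : Set where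
      field
        blossom         : Blossom
      open Blossom blossom
      field
        {base end}      : Fin n
        isBase          : IsBase base
        end-unsaturated : Unsaturated end
        stem            : Walk G base end
        stem-path       : IsPath stem
        stem-alt        : Alternating stem
        stem-even       : 2 ∣ ∥ stem ∥
        onlyBaseShared  : ∀ {x} → x ∈ cycleVertices → x ∈ vertices stem → x ≡ base

      Contains : Pred (Fin n) 0ℓ
      Contains v = v ∈ cycleVertices ⊎ v ∈ vertices stem

    record Posy : Set where
      field
        blossom₁ blossom₂ : Blossom
      module B₁ = Blossom blossom₁
      module B₂ = Blossom blossom₂
      field
        distinct          : ¬ SameCycle B₁.cycle B₂.cycle
        {base₁ base₂}     : Fin n
        isBase₁           : B₁.IsBase base₁
        isBase₂           : B₂.IsBase base₂
        path              : Walk G base₁ base₂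
        isPath            : IsPath path
        path-mm           : MMAlternating path
        path-odd          : 2 ∤ ∥ path ∥

      Contains : Pred (Fin n) 0ℓ
      Contains v = v ∈ B₁.cycleVertices ⊎ v ∈ B₂.cycleVertices ⊎ v ∈ vertices path

    record Tposy : Set where
      field
        posy : Posy
      open Posy posy public
      field
        internallyDisjoint : ∀ {x} → x ∈ vertices path → x ≢ base₁ → x ≢ base₂ →
                             x ∉ B₁.cycleVertices × x ∉ B₂.cycleVertices

    record Jflower : Set where
      field
        blossom         : Blossom
      open Blossom blossom
      field
        {base end}      : Fin n
        isBase          : IsBase base
        end-unsaturated : Unsaturated end
        walk            : Walk G base end
        walk-alt        : Alternating walk
        walk-even       : 2 ∣ ∥ walk ∥

      Contains : Pred (Fin n) 0ℓ
      Contains v = v ∈ cycleVertices ⊎ v ∈ vertices walk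

    record Jposy : Set where
      field
        blossom₁ blossom₂ : Blossom
      module B₁ = Blossom blossom₁
      module B₂ = Blossom blossom₂
      field
        {base₁ base₂}     : Fin n
        isBase₁           : B₁.IsBase base₁
        isBase₂           : B₂.IsBase base₂
        walk              : Walk G base₁ base₂
        walk-mm           : MMAlternating walk
        walk-odd          : 2 ∤ ∥ walk ∥

      Contains : Pred (Fin n) 0ℓ
      Contains v = v ∈ B₁.cycleVertices ⊎ v ∈ B₂.cycleVertices ⊎ v ∈ vertices walk

module _ {n : ℕ} (G : Graph n) where

  InFlower InPosy InTposy InJflower InJposy : Pred (Fin n) 0ℓ
  InFlower  v = Σ[ M ∈ Matching G ] Maximum G M × Σ[ F ∈ Flower M ]  Flower.Contains F v
  InPosy    v = Σ[ M ∈ Matching G ] Maximum G M × Σ[ P ∈ Posy M ]    Posy.Contains P v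
  InTposy   v = Σ[ M ∈ Matching G ] Maximum G M × Σ[ P ∈ Tposy M ]   Tposy.Contains P v
  InJflower v = Σ[ M ∈ Matching G ] Maximum G M × Σ[ F ∈ Jflower M ] Jflower.Contains F v
  InJposy   v = Σ[ M ∈ Matching G ] Maximum G M × Σ[ P ∈ Jposy M ]   Jposy.Contains P v

  V-T V-ESG V-J : Pred (Fin n) 0ℓ
  V-T   = InFlower ∪ InTposy
  V-ESG = InFlower ∪ InPosy
  V-J   = InJflower ∪ InJposy

{-# OPTIONS --safe #-}
module Submission where

-- Let σ exchange the ends of each edge of a maximum matching and fix the unsaturated vertices,
-- and write x → y if x–σ y is an unmatched edge. This digraph is skew-symmetric (x → y iff σ y → σ x),
-- and every vertex v of a J-flower or J-posy satisfies v ⇒⁺ σ v ⇒ v. Conversely, suppose v is saturated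
-- and satisfies this. Shortening both walks gives either a path through v whose two ends run into
-- blossoms or unsaturated vertices, that is, a T-posy or a flower through v (or an augmenting path), or
-- else an alternating cycle Z through v. On Z the vertices reachable from v along Z are black, their mates
-- white; since v ⇒ σ v ⇒ v, there is an ear of Z joining two black vertices and one joining two white
-- vertices. If the pairs of ends do not cross on Z, then, possibly after switching the matching along Z,
-- some unmatched edge of Z can be deleted while v ⇒ σ v ⇒ v persists, and one concludes by induction on
-- the number of edges. If they cross, Z and the ears form a T-posy whose blossoms overlap.

open import Data.Bool using (Bool; true; false; if_then_else_)
open import Data.Bool.Properties using (T?)
open import Data.Empty using (⊥)
open import Data.Fin using (Fin) renaming (_<_ to _<ᶠ_)
open import Data.Fin.Properties using (_≟_; any?) renaming (_<?_ to _<ᶠ?_; <-asym to <ᶠ-asym; <-cmp to <ᶠ-cmp)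
open import Data.List using (List; []; _∷_; _++_; length; filter; allFin; cartesianProduct; map; head; last)
open import Data.List.Membership.Propositional using (_∈_; _∉_)
open import Data.List.Membership.Propositional.Properties
  using (∈-++⁺ˡ; ∈-++⁺ʳ; ∈-++⁻; ∈-∃++; ∈-filter⁺; ∈-filter⁻; ∈-cartesianProduct⁺; ∈-cartesianProduct⁻; ∈-allFin)
open import Data.List.Properties
  using (++-assoc; length-++; length-map; filter-++; filter-accept; filter-reject; filter-notAll)
open import Data.List.Relation.Unary.All as All using (All; []; _∷_)
import Data.List.Relation.Unary.All.Properties as All
open import Data.List.Relation.Unary.AllPairs using (AllPairs; []; _∷_)
import Data.List.Relation.Unary.AllPairs.Properties as AllPairs
open import Data.List.Relation.Unary.Any as Any using (here; there)
open import Data.List.Relation.Unary.Linked using ([]; [-]; _∷_)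
open import Data.List.Relation.Unary.Unique.Propositional using (Unique)
import Data.List.Relation.Unary.Unique.Propositional.Properties as Unique
open import Data.Maybe.Relation.Unary.Any using (just) renaming (Any to AnyMaybe)
open import Data.Nat
  using (ℕ; zero; suc; pred; _+_; _*_; _∸_; _≤_; _<_; z≤n; s≤s; _≤′_; ≤′-refl; ≤′-step; >-nonZero)
open import Data.Nat.Divisibility using (_∣_; _∤_; divides; ∣m+n∣m⇒∣n; ∣-refl; ∣⇒≤; m∣m*n)
open import Data.Nat.Induction using (<-wellFounded; Acc; acc)
open import Data.Nat.Properties
  using (≤-refl; ≤-trans; ≤-reflexive; ≤-total; <-trans; ≤-<-trans; <-≤-trans; <⇒≤; <⇒≢; >⇒≢; ≰⇒>; <-irrefl; <-cmp;
         1+n≰n; n≤1+n; ≤-pred; m<n⇒m<1+n; m≤n⇒m≤1+n; m≤n⇒m<n∨m≡n; ≤⇒≤′; ≤′⇒≤; anyUpTo?; _≤?_; suc-injective; suc-pred;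
         +-suc; +-comm; *-cancelˡ-≤; *-cancelˡ-<; m∸n≤m; n∸n≡0; m∸[m∸n]≡n; m<n⇒0<n∸m; ∸-monoʳ-<; ∸-monoʳ-≤)
  renaming (_≟_ to _≟ℕ_)
open import Data.Product using (Σ-syntax; ∃; ∃₂; _×_; _,_; proj₁; proj₂)
open import Data.Sum using (_⊎_; inj₁; inj₂; swap)
open import Function using (_∘_)
open import Function.Bundles using (Equivalence)
open import Level using (0ℓ)
open import Relation.Binary.Construct.Closure.ReflexiveTransitive using (Star; ε; _◅_; _◅◅_)
open import Relation.Binary.Construct.Closure.ReflexiveTransitive.Properties using (◅◅-assoc)
open import Relation.Binary.Core using (Rel)
open import Relation.Binary.Definitions using (tri<; tri≈; tri>)
open import Relation.Binary.PropositionalEquality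
  using (_≡_; _≢_; refl; sym; trans; cong; cong₂; subst; subst₂; ≢-sym)
open import Relation.Nullary using (¬_; Dec; yes; no; contradiction)
open import Relation.Nullary.Decidable using (¬?; _×-dec_; _⊎-dec_; ⌊_⌋; toWitness; fromWitness)
open import Relation.Unary using (_≐_; _⊆_)

open import Defs

-- Shortening a walk is easy; the obstacle is to keep `v` on it. The two sides of a path through `v`
-- must avoid each other, while the blossoms at its ends may overlap, so `Config` puts no condition
-- on `rˡ` against `rʳ`. A collision of the two sides closes a cycle, and there the matching and the
-- edge set may have to change. Only the two walks between `v` and `σ v` are carried through such a
-- change. Edges may be dropped since a configuration on fewer edges is still one in the graph, and
-- no change makes a saturated vertex unsaturated, so the matching reached at the end is still
-- maximum. Switching is needed because of ears whose white ends both precede the black ones on the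
-- cycle: with the cycle and the ears alone, deleting any unmatched edge of the cycle then cuts `v`
-- off from both black ends or `σ v` off from both white ends. Switching reverses the order of the
-- ends while `v` stays black.

AllPairs-++⁻ : ∀ {A : Set} {R : Rel A 0ℓ} xs {ys} → AllPairs R (xs ++ ys) →
               AllPairs R xs × AllPairs R ys × (∀ {x y} → x ∈ xs → y ∈ ys → R x y)
AllPairs-++⁻ []       rs       = [] , rs , λ ()
AllPairs-++⁻ (x ∷ xs) (r ∷ rs) with AllPairs-++⁻ xs rs | All.++⁻ xs r
... | rxs , rys , c | r₁ , r₂ =
  r₁ ∷ rxs , rys , λ { (here refl) y∈ → All.lookup r₂ y∈ ; (there x∈) y∈ → c x∈ y∈ }

-- An edge set together with an involution on the vertices: σ exchanges the ends
-- of each matching edge and fixes the unsaturated vertices.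
record Structure {n : ℕ} (G : Graph n) : Set where
  open Graph G
  field
    edgeList : List (Fin n × Fin n)

  E : Rel (Fin n) 0ℓ
  E x y = (x , y) ∈ edgeList

  field
    E-sym : ∀ {x y} → E x y → E y x
    E⇒Adj : ∀ {x y} → E x y → Adj x y
    σ     : Fin n → Fin n
    σσ    : ∀ x → σ (σ x) ≡ x

  E-irrefl : ∀ {x} → ¬ E x x
  E-irrefl e = adj-irrefl refl (E⇒Adj e)

-- The skew-symmetric digraph and its regular paths

module Digraph {n : ℕ} {G : Graph n} (S : Structure G) where
  open Structure S

  -- An arc x → y stands for the unmatched edge x–σ y followed by the matching edge
  -- σ y–y; if y is unsaturated, the second edge is missing.
  Arc : Rel (Fin n) 0ℓ
  Arc x y = E x (σ y) × x ≢ y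

  Apart : Rel (Fin n) 0ℓ
  Apart x y = x ≢ y × x ≢ σ y

  -- Distinct entries are not enough: a walk in the digraph may pass a matching edge in both
  -- directions, and then it is not a path of `G`.
  Regular : List (Fin n) → Set
  Regular = AllPairs Apart

  Saturated : Fin n → Set
  Saturated x = σ x ≢ x

  infix 4 _∥_
  _∥_ : List (Fin n) → List (Fin n) → Set
  xs ∥ ys = ∀ {x y} → x ∈ xs → y ∈ ys → Apart x y

  data Path : Fin n → Fin n → List (Fin n) → Set where
    ⟨_⟩ : ∀ x → Path x x (x ∷ [])
    _∷_ : ∀ {x y z xs} → Arc x y → Path y z xs → Path x z (x ∷ xs)

  -- The vertex list of the mirror image of a path: skew symmetry reverses the arcs and replaces
  -- vertices by their mates.
  revσ : List (Fin n) → List (Fin n)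
  revσ []       = []
  revσ (x ∷ xs) = revσ xs ++ σ x ∷ []

  σ-injective : ∀ {x y} → σ x ≡ σ y → x ≡ y
  σ-injective {x} {y} e = trans (sym (σσ x)) (trans (cong σ e) (σσ y))

  σ-swap : ∀ {x y} → x ≡ σ y → σ x ≡ y
  σ-swap {x} {y} e = trans (cong σ e) (σσ y)

  σ-swap′ : ∀ {x y} → σ x ≡ y → x ≡ σ y
  σ-swap′ {x} e = trans (sym (σσ x)) (cong σ e)

  Apart-sym : ∀ {x y} → Apart x y → Apart y x
  Apart-sym (a , b) = ≢-sym a , λ e → b (sym (σ-swap e))

  Apart-σˡ : ∀ {x y} → Apart x y → Apart (σ x) y
  Apart-σˡ (a , b) = (λ e → b (σ-swap′ e)) , λ e → a (σ-injective e)

  Apart-σʳ : ∀ {x y} → Apart x y → Apart x (σ y)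
  Apart-σʳ = Apart-sym ∘ Apart-σˡ ∘ Apart-sym

  ∥-sym : ∀ {xs ys} → xs ∥ ys → ys ∥ xs
  ∥-sym p y∈ x∈ = Apart-sym (p x∈ y∈)

  Regular-++⁻ : ∀ xs {ys} → Regular (xs ++ ys) → Regular xs × Regular ys × xs ∥ ys
  Regular-++⁻ xs r = AllPairs-++⁻ xs r

  Regular-++⁺ : ∀ {xs ys} → Regular xs → Regular ys → xs ∥ ys → Regular (xs ++ ys)
  Regular-++⁺ rx ry p = AllPairs.++⁺ rx ry (All.tabulate λ x∈ → All.tabulate λ y∈ → p x∈ y∈)

  Regular-[] : ∀ {x} → Regular (x ∷ [])
  Regular-[] = [] ∷ []

  Regular-∷ : ∀ {x xs} → (x ∷ []) ∥ xs → Regular xs → Regular (x ∷ xs)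
  Regular-∷ p r = All.tabulate (p (here refl)) ∷ r

  ∥-++ : ∀ xs {ys zs} → xs ∥ zs → ys ∥ zs → (xs ++ ys) ∥ zs
  ∥-++ xs p q x∈ z∈ with ∈-++⁻ xs x∈
  ... | inj₁ i = p i z∈
  ... | inj₂ i = q i z∈

  fresh : ∀ {z xs} → z ∉ xs → σ z ∉ xs → (z ∷ []) ∥ xs
  fresh p q (here refl) y∈ = (λ { refl → p y∈ }) , λ e → q (subst (_∈ _) (sym (σ-swap e)) y∈)

  ∈-revσ⁻ : ∀ xs {y} → y ∈ revσ xs → σ y ∈ xs
  ∈-revσ⁻ (x ∷ xs) y∈ with ∈-++⁻ (revσ xs) y∈
  ... | inj₁ i           = there (∈-revσ⁻ xs i)
  ... | inj₂ (here refl) = here (σσ x)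

  ∈-revσ⁺ : ∀ {xs y} → σ y ∈ xs → y ∈ revσ xs
  ∈-revσ⁺ {x ∷ xs} (here refl) = ∈-++⁺ʳ (revσ xs) (here (sym (σσ _)))
  ∈-revσ⁺ {x ∷ xs} (there i)   = ∈-++⁺ˡ (∈-revσ⁺ i)

  ∥-revσ : ∀ {xs ys} → xs ∥ ys → xs ∥ revσ ys
  ∥-revσ {ys = ys} p x∈ y∈ = subst (Apart _) (σσ _) (Apart-σʳ (p x∈ (∈-revσ⁻ ys y∈)))

  Regular-revσ : ∀ {xs} → Regular xs → Regular (revσ xs)
  Regular-revσ []       = []
  Regular-revσ (a ∷ as) = Regular-++⁺ (Regular-revσ as) Regular-[]
    (∥-sym (∥-revσ λ { (here refl) y∈ → Apart-σˡ (All.lookup a y∈) }))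

  All-revσ : ∀ {P : Fin n → Set} → (∀ {x} → P x → P (σ x)) → ∀ {xs} → All P xs → All P (revσ xs)
  All-revσ f []       = []
  All-revσ f (p ∷ ps) = All.++⁺ (All-revσ f ps) (f p ∷ [])

  Saturated-σ : ∀ {x} → Saturated x → Saturated (σ x)
  Saturated-σ p e = p (σ-injective e)

  Arc-σ : ∀ {x y} → Arc x y → Arc (σ y) (σ x)
  Arc-σ {x} (e , ne) = subst (E _) (sym (σσ x)) (E-sym e) , λ q → ne (sym (σ-injective q))

  ¬Arc-σ : ∀ {x} → ¬ Arc x (σ x)
  ¬Arc-σ {x} (e , _) = E-irrefl (subst (E x) (σσ x) e)

  Star-σ : ∀ {x y} → Star Arc x y → Star Arc (σ y) (σ x)
  Star-σ ε        = ε
  Star-σ (a ◅ as) = Star-σ as ◅◅ Arc-σ a ◅ ε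

  infixr 5 _▷_◁_
  _▷_◁_ : ∀ {x y z w xs ys} → Path x y xs → Arc y z → Path z w ys → Path x w (xs ++ ys)
  ⟨ _ ⟩   ▷ a ◁ q = a ∷ q
  (b ∷ p) ▷ a ◁ q = b ∷ (p ▷ a ◁ q)

  Path-σ : ∀ {x y xs} → Path x y xs → Path (σ y) (σ x) (revσ xs)
  Path-σ ⟨ x ⟩   = ⟨ σ x ⟩
  Path-σ (a ∷ p) = Path-σ p ▷ Arc-σ a ◁ ⟨ _ ⟩

  head∈ : ∀ {x y xs} → Path x y xs → x ∈ xs
  head∈ ⟨ _ ⟩   = here refl
  head∈ (a ∷ p) = here refl

  last∈ : ∀ {x y xs} → Path x y xs → y ∈ xs
  last∈ ⟨ _ ⟩   = here refl
  last∈ (a ∷ p) = there (last∈ p)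

  head-≡ : ∀ {x y z xs} → Path x y (z ∷ xs) → x ≡ z
  head-≡ ⟨ _ ⟩   = refl
  head-≡ (a ∷ p) = refl

  path-split : ∀ {x z} xs {y ys} → Path x z (xs ++ y ∷ ys) →
               (xs ≡ [] × x ≡ y ⊎ ∃ λ t → Path x t xs × Arc t y) × Path y z (y ∷ ys)
  path-split []       p with refl ← head-≡ p = inj₁ (refl , refl) , p
  path-split (x ∷ []) (a ∷ p) with refl ← head-≡ p = inj₂ (x , ⟨ x ⟩ , a) , p
  path-split (x ∷ xs@(_ ∷ _)) (a ∷ p) with path-split xs p
  ... | inj₂ (t , p′ , b) , q = inj₂ (t , a ∷ p′ , b) , q

-- Extending a path until it is capped

module Caps {n : ℕ} {G : Graph n} (S : Structure G) where
  open Structure S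
  open Digraph S
  open import Data.List.Membership.DecPropositional (_≟_ {n}) using (_∈?_)

  -- What a path may run into at its end s: a blossom with base s whose other vertices
  -- are the given list and its mates, or an unsaturated vertex.
  data Cap (s : Fin n) : List (Fin n) → Set where
    loop : ∀ {h t r} → Arc s h → Path h t r → Arc t (σ s) → Cap s r
    stop : ∀ {y} → σ y ≡ y → Arc s y → Cap s []

  data StopsAt (x : Fin n) : ∀ {s r} → Cap s r → Set where
    stopsAt : ∀ {s} (fixed : σ x ≡ x) (a : Arc s x) → StopsAt x (stop fixed a)

  -- With two loops this is a T-posy with bases σ c and s, with one loop a flower.
  record Config : Set where
    field
      {c s}     : Fin n
      {D rˡ rʳ} : List (Fin n)
      path      : Path c s D
      capˡ      : Cap (σ c) rˡ
      capʳ      : Cap s rʳ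
      regularˡ  : Regular (rˡ ++ D)
      regularʳ  : Regular (rʳ ++ D)
      satˡ      : All Saturated (rˡ ++ D)
      satʳ      : All Saturated rʳ

  record ClosedPath (x : Fin n) : Set where
    field
      {end}     : Fin n
      {L}       : List (Fin n)
      path      : Path x end L
      closing   : Arc end x
      regular   : Regular L
      saturated : All Saturated L

  record Route (T : List (Fin n)) (x w : Fin n) : Set where
    field
      {Y}       : List (Fin n)
      path      : Path x w Y
      regular   : Regular Y
      saturated : All Saturated Y
      within    : ∀ {y} → y ∈ Y → y ∈ T ⊎ σ y ∈ T

  -- A walk is followed backwards from the start x₀ of the path x₀ ∷ S′, prepending its vertices
  -- to that path, until the extended path acquires a cap at its start or hits what lies beyond x₀.
  module Extend {x₀ s : Fin n} {S′ r : List (Fin n)}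
                (sat₀ : All Saturated (x₀ ∷ S′))
                (route : ∀ {w} → w ∈ S′ ⊎ w ∈ r ⊎ σ w ∈ r → Route ((x₀ ∷ S′) ++ r) x₀ w) where

    Hit : Set
    Hit = (∃ λ w → w ∈ S′ ⊎ w ∈ r ⊎ σ w ∈ r) × ClosedPath x₀

    record Capped : Set where
      field
        {c}    : Fin n
        {D rˡ} : List (Fin n)
        path   : Path c s D
        cap    : Cap (σ c) rˡ
        regular : Regular (rˡ ++ D)
        saturated : All Saturated (rˡ ++ D)
        apart  : D ∥ r
        covers : x₀ ∈ rˡ ++ D

    -- An arc from `y` to `z` has a mirror image from `σ z` to `σ y`, which can be put in front of
    -- the path. When the walk is at `y`, the path therefore starts at `σ y`.
    record State (y : Fin n) : Set where
      field
        {A}       : List (Fin n)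
        path      : Path (σ y) s (A ++ x₀ ∷ S′)
        regular   : Regular ((A ++ x₀ ∷ S′) ++ r)
        saturated : All Saturated A

    close : ∀ {y z} → State y → Arc y z → Route ((x₀ ∷ S′) ++ r) x₀ (σ z) → ClosedPath x₀
    close {y} {z} st a ρ with path-split A path
      where open State st
    ... | inj₁ (refl , eq) , _ = record
      { path = Route.path ρ ; closing = subst (Arc (σ z)) eq (Arc-σ a)
      ; regular = Route.regular ρ ; saturated = Route.saturated ρ }
    ... | inj₂ (t , p , b) , _ = record
      { path = Route.path ρ ▷ Arc-σ a ◁ p ; closing = b
      ; regular = Regular-++⁺ (Route.regular ρ) (proj₁ (Regular-++⁻ A regD)) apart
      ; saturated = All.++⁺ (Route.saturated ρ) (State.saturated st) }
      where
      open State st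
      regD = proj₁ (Regular-++⁻ (A ++ x₀ ∷ S′) regular)
      A∥T : A ∥ (x₀ ∷ S′) ++ r
      A∥T x∈ y∈ with ∈-++⁻ (x₀ ∷ S′) y∈
      ... | inj₁ i = proj₂ (proj₂ (Regular-++⁻ A regD)) x∈ i
      ... | inj₂ i = proj₂ (proj₂ (Regular-++⁻ (A ++ x₀ ∷ S′) regular)) (∈-++⁺ˡ x∈) i
      apart : Route.Y ρ ∥ A
      apart y∈ x∈ with Route.within ρ y∈
      ... | inj₁ i = Apart-sym (A∥T x∈ i)
      ... | inj₂ i = subst (λ u → Apart u _) (σσ _) (Apart-σˡ (Apart-sym (A∥T x∈ i)))

    hit : ∀ {y z} → State y → Arc y z → σ z ∈ S′ ⊎ σ z ∈ r ⊎ σ (σ z) ∈ r → Hit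
    hit st a i = (_ , i) , close st a (route i)

    Regular-suffix : ∀ A {B} → Regular ((A ++ B) ++ r) → Regular (B ++ r)
    Regular-suffix A {B} reg = proj₁ (proj₂ (Regular-++⁻ A (subst Regular (++-assoc A B r) reg)))

    -- If `z` is unsaturated, the start is capped by a stop. If `z` lies on the path, the part
    -- before it is the loop of a blossom with base `σ z`. If `σ z` lies in `A` or is `x₀`, the path
    -- is cut back to it. A hit beyond `x₀` is closed up by a route. Otherwise `σ z` is prepended.
    -- In no case is `x₀` cut off.
    step : ∀ {y z} → State y → Arc y z → (Capped ⊎ Hit) ⊎ State z
    step {y} {z} st a with σ z ≟ z
    ... | yes fixed = inj₁ (inj₁ record
      { path = path ; cap = stop fixed (subst (λ u → Arc u z) (sym (σσ y)) a)
      ; regular = proj₁ (Regular-++⁻ (A ++ x₀ ∷ S′) regular)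
      ; saturated = All.++⁺ saturated sat₀
      ; apart = proj₂ (proj₂ (Regular-++⁻ (A ++ x₀ ∷ S′) regular))
      ; covers = ∈-++⁺ʳ A (here refl) })
      where open State st
    ... | no z-sat with z ∈? (State.A st ++ x₀ ∷ S′)
    ... | yes z∈ with ∈-∃++ z∈
    ...   | A₁ , D₂ , eq with path-split A₁ (subst (Path _ s) eq (State.path st))
    ...     | inj₁ (_ , refl) , _ = contradiction a ¬Arc-σ
    ...     | inj₂ (t , p , b) , q = inj₁ (inj₁ record
      { path = q ; cap = loop (Arc-σ a) p (subst (Arc t) (sym (σσ z)) b)
      ; regular = subst Regular eq (proj₁ (Regular-++⁻ (A ++ x₀ ∷ S′) regular))
      ; saturated = subst (All Saturated) eq (All.++⁺ saturated sat₀)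
      ; apart = λ x∈ → proj₂ (proj₂ (Regular-++⁻ (A ++ x₀ ∷ S′) regular))
                         (subst (_ ∈_) (sym eq) (∈-++⁺ʳ A₁ x∈))
      ; covers = subst (x₀ ∈_) eq (∈-++⁺ʳ A (here refl)) })
      where open State st
    step {y} {z} st a | no z-sat | no z∉ with σ z ∈? State.A st
    ... | yes i with ∈-∃++ i
    ...   | A₁ , A₂ , refl = inj₂ record
      { A = σ z ∷ A₂
      ; path = proj₂ (path-split A₁ (subst (Path _ s) (++-assoc A₁ _ _) path))
      ; regular = Regular-suffix A₁ (subst (λ l → Regular (l ++ r)) (++-assoc A₁ _ _) regular)
      ; saturated = All.++⁻ʳ A₁ saturated }
      where open State st
    step {y} {z} st a | no z-sat | no z∉ | no σz∉A with σ z ≟ x₀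
    ... | yes refl = inj₂ record
      { A = [] ; path = proj₂ (path-split A path) ; regular = Regular-suffix A regular ; saturated = [] }
      where open State st
    ... | no σz≢x₀ with σ z ∈? S′ | σ z ∈? r | z ∈? r
    ... | yes i | _     | _     = inj₁ (inj₂ (hit st a (inj₁ i)))
    ... | no _  | yes i | _     = inj₁ (inj₂ (hit st a (inj₂ (inj₁ i))))
    ... | no _  | no _  | yes i = inj₁ (inj₂ (hit st a (inj₂ (inj₂ (subst (_∈ r) (sym (σσ z)) i)))))
    ... | no σz∉S′ | no σz∉r | no z∉r = inj₂ record
      { path = Arc-σ a ∷ path
      ; regular = Regular-∷ (fresh σz∉ z∉′) regular
      ; saturated = (z-sat ∘ σ-injective) ∷ saturated }
      where
      open State st
      σz∉ : σ z ∉ (A ++ x₀ ∷ S′) ++ r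
      σz∉ i with ∈-++⁻ (A ++ x₀ ∷ S′) i
      ... | inj₂ j = σz∉r j
      ... | inj₁ j with ∈-++⁻ A j
      ...   | inj₁ k           = σz∉A k
      ...   | inj₂ (here k)    = σz≢x₀ k
      ...   | inj₂ (there k)   = σz∉S′ k
      z∉′ : σ (σ z) ∉ (A ++ x₀ ∷ S′) ++ r
      z∉′ i with ∈-++⁻ (A ++ x₀ ∷ S′) (subst (_∈ _) (σσ z) i)
      ... | inj₁ j = z∉ j
      ... | inj₂ j = z∉r j

    extend : ∀ {y z} → State y → Star Arc y z → (Capped ⊎ Hit) ⊎ State z
    extend st ε        = inj₂ st
    extend st (a ◅ as) with step st a
    ... | inj₁ out = inj₁ out
    ... | inj₂ st′ = extend st′ as

-- From two walks to a capped path or a closed path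

module Search {n : ℕ} {G : Graph n} (S : Structure G) where
  open Structure S
  open Digraph S
  open Caps S

  path-prefix : ∀ {x z} xs {y ys} → Path x z (xs ++ y ∷ ys) → Path x y (xs ++ y ∷ [])
  path-prefix xs p with path-split xs p
  ... | inj₁ (refl , refl) , _ = ⟨ _ ⟩
  ... | inj₂ (t , q , a) , _   = q ▷ a ◁ ⟨ _ ⟩

  Regular-prefix : ∀ xs {y ys} → Regular (xs ++ y ∷ ys) → Regular (xs ++ y ∷ [])
  Regular-prefix xs {y} {ys} r =
    proj₁ (Regular-++⁻ (xs ++ y ∷ []) (subst Regular (sym (++-assoc xs (y ∷ []) ys)) r))

  All-prefix : ∀ {P : Fin n → Set} xs {y ys} → All P (xs ++ y ∷ ys) → All P (xs ++ y ∷ [])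
  All-prefix {P} xs {y} {ys} r = All.++⁻ˡ (xs ++ y ∷ []) (subst (All P) (sym (++-assoc xs (y ∷ []) ys)) r)

  ∈-prefix : ∀ {x : Fin n} xs {y ys} → x ∈ xs ++ y ∷ [] → x ∈ xs ++ y ∷ ys
  ∈-prefix xs {y} {ys} i = subst (λ l → _ ∈ l) (++-assoc xs (y ∷ []) ys) (∈-++⁺ˡ i)

  -- A loop can be entered at both of its ends, so its vertices are reached in one direction and
  -- their mates in the other.
  routes : ∀ {x s xs r} → Path x s xs → Cap s r → Regular (xs ++ r) →
           All Saturated xs → All Saturated r →
           ∀ {w} → w ∈ xs ⊎ w ∈ r ⊎ σ w ∈ r → Route (xs ++ r) x w
  routes {xs = xs} p κ reg sat satʳ (inj₁ i) with ∈-∃++ i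
  ... | B , _ , refl = record
    { path = path-prefix B p ; regular = Regular-prefix B (proj₁ (Regular-++⁻ xs reg))
    ; saturated = All-prefix B sat ; within = λ j → inj₁ (∈-++⁺ˡ (∈-prefix B j)) }
  routes {xs = xs} p (loop a q b) reg sat satʳ (inj₂ (inj₁ i)) with ∈-∃++ i | Regular-++⁻ xs reg
  ... | B , _ , refl | r₁ , r₂ , ap = record
    { path = p ▷ a ◁ path-prefix B q
    ; regular = Regular-++⁺ r₁ (Regular-prefix B r₂) (λ x∈ y∈ → ap x∈ (∈-prefix B y∈))
    ; saturated = All.++⁺ sat (All-prefix B satʳ)
    ; within = λ j → inj₁ (within j) }
    where
    within : ∀ {y z zs} → y ∈ xs ++ B ++ z ∷ [] → y ∈ xs ++ B ++ z ∷ zs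
    within j with ∈-++⁻ xs j
    ... | inj₁ k = ∈-++⁺ˡ k
    ... | inj₂ k = ∈-++⁺ʳ xs (∈-prefix B k)
  routes {s = s} {xs = xs} p (loop {t = t} {r = r} a q b) reg sat satʳ {w} (inj₂ (inj₂ i))
    with ∈-∃++ i | Regular-++⁻ xs reg
  ... | B , B′ , refl | r₁ , r₂ , ap = record
    { path = p ▷ subst (λ u → Arc u (σ t)) (σσ s) (Arc-σ b) ◁
             subst (λ u → Path (σ t) u (revσ (σ w ∷ B′))) (σσ w) (Path-σ (proj₂ (path-split B q)))
    ; regular = Regular-++⁺ r₁ (Regular-revσ (proj₁ (proj₂ (Regular-++⁻ B r₂))))
                  (∥-revσ (λ x∈ y∈ → ap x∈ (∈-++⁺ʳ B y∈)))
    ; saturated = All.++⁺ sat (All-revσ Saturated-σ (All.++⁻ʳ B satʳ))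
    ; within = within }
    where
    within : ∀ {y} → y ∈ xs ++ revσ (σ w ∷ B′) → y ∈ xs ++ r ⊎ σ y ∈ xs ++ r
    within j with ∈-++⁻ xs j
    ... | inj₁ k = inj₁ (∈-++⁺ˡ k)
    ... | inj₂ k = inj₂ (∈-++⁺ʳ xs (∈-++⁺ʳ B (∈-revσ⁻ (σ w ∷ B′) k)))

  Covers : Config → Fin n → Set
  Covers C x = (x ∈ rˡ ++ D ⊎ σ x ∈ rˡ ++ D) ⊎ StopsAt x capʳ
    where open Config C

  -- This excludes that an extension uses up its whole walk: the walk leads to `x₀`, so the path
  -- would begin with `σ x₀` and still contain `x₀`.
  no-return : ∀ {x₀ s S′} A {r} {W : Set} → Saturated x₀ → Path (σ x₀) s (A ++ x₀ ∷ S′) →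
              Regular ((A ++ x₀ ∷ S′) ++ r) → W
  no-return []      sat p reg = contradiction (head-≡ p) sat
  no-return (_ ∷ A) sat p reg with refl ← head-≡ p =
    contradiction refl (proj₂ (proj₂ (proj₂ (Regular-++⁻ (_ ∷ A)
      (proj₁ (Regular-++⁻ (_ ∷ A ++ _) reg)))) (here refl) (here refl)))

  head-∷ : ∀ {x y xs} → Path x y xs → ∃ λ xs′ → xs ≡ x ∷ xs′
  head-∷ ⟨ _ ⟩   = _ , refl
  head-∷ (_ ∷ _) = _ , refl

  nowhere : ∀ {x₀ w : Fin n} → w ∈ [] ⊎ w ∈ [] ⊎ σ w ∈ [] → Route ((x₀ ∷ []) ++ []) x₀ w
  nowhere (inj₂ (inj₁ ()))
  nowhere (inj₂ (inj₂ ()))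

  module Isolated {s : Fin n} (sat : Saturated s) =
    Extend {s} {s} {[]} {[]} (sat ∷ []) nowhere

  ¬Hit : ∀ {s} (sat : Saturated s) → ¬ Isolated.Hit sat
  ¬Hit sat ((_ , inj₂ (inj₁ ())) , _)
  ¬Hit sat ((_ , inj₂ (inj₂ ())) , _)

  initial : ∀ {s} (sat : Saturated s) → Isolated.State sat (σ s)
  initial {s} sat = record
    { A = [] ; path = subst (λ u → Path u s (s ∷ [])) (sym (σσ s)) ⟨ s ⟩
    ; regular = Regular-[] ; saturated = [] }

  -- Extending the single vertex `v` along the second walk yields a path into `v` with a capped
  -- start, as there is nothing beyond `v` to hit. Its mirror image leaves `σ v` with the cap at its
  -- far end and is extended along the first walk; a hit now closes a cycle.
  configOrCycle : ∀ {v} → Saturated v → Star Arc v (σ v) → Star Arc (σ v) v →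
                  (∃ λ C → Covers C v) ⊎ ClosedPath (σ v)
  configOrCycle {v} sat w w′ with Isolated.extend sat (initial sat) w′
  ... | inj₁ (inj₂ h) = contradiction h (¬Hit sat)
  ... | inj₂ st = no-return A sat path regular
    where open Isolated.State sat st
  ... | inj₁ (inj₁ κ) = second (head-∷ (Path-σ path))
    where
    open Isolated.Capped sat κ
    regs = Regular-++⁻ rˡ regular
    regD : Regular (revσ D ++ rˡ)
    regD = Regular-++⁺ (Regular-revσ (proj₁ (proj₂ regs))) (proj₁ regs) (∥-sym (∥-revσ (proj₂ (proj₂ regs))))
    satD : All Saturated (revσ D)
    satD = All-revσ Saturated-σ (All.++⁻ʳ rˡ saturated)
    module Second {S′} (eq : revσ D ≡ σ v ∷ S′) where
      p : Path (σ v) (σ c) (σ v ∷ S′)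
      p = subst (Path (σ v) (σ c)) eq (Path-σ path)
      reg : Regular ((σ v ∷ S′) ++ rˡ)
      reg = subst (λ l → Regular (l ++ rˡ)) eq regD
      satS : All Saturated (σ v ∷ S′)
      satS = subst (All Saturated) eq satD
      beyond : ∀ {w} → w ∈ S′ ⊎ w ∈ rˡ ⊎ σ w ∈ rˡ → Route ((σ v ∷ S′) ++ rˡ) (σ v) w
      beyond (inj₁ i) = routes p cap reg satS (All.++⁻ˡ rˡ saturated) (inj₁ (there i))
      beyond (inj₂ i) = routes p cap reg satS (All.++⁻ˡ rˡ saturated) (inj₂ i)
      module X = Extend {σ v} {σ c} {S′} {rˡ} satS beyond
      result : (∃ λ C → Covers C v) ⊎ ClosedPath (σ v)
      result with X.extend (record { A = [] ; path = p ; regular = reg ; saturated = [] }) w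
      ... | inj₁ (inj₂ (_ , h)) = inj₂ h
      ... | inj₂ st = no-return (X.State.A st) (Saturated-σ sat) (X.State.path st) (X.State.regular st)
      ... | inj₁ (inj₁ κ′) = inj₁ (record
        { path = X.Capped.path κ′ ; capˡ = X.Capped.cap κ′ ; capʳ = cap
        ; regularˡ = X.Capped.regular κ′
        ; regularʳ = Regular-++⁺ (proj₁ regs)
            (proj₁ (proj₂ (Regular-++⁻ (X.Capped.rˡ κ′) (X.Capped.regular κ′)))) (∥-sym (X.Capped.apart κ′))
        ; satˡ = X.Capped.saturated κ′ ; satʳ = All.++⁻ˡ rˡ saturated }
        , inj₁ (inj₂ (X.Capped.covers κ′)))
    second : (∃ λ S′ → revσ D ≡ σ v ∷ S′) → _
    second (_ , eq) = Second.result eq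

  -- The mirror image of the walk ends in the unsaturated `v`, so the backward extension from `s`
  -- cannot use it up without being capped. The arc to `v` is the other cap.
  unsaturatedConfig : ∀ {v s} → σ v ≡ v → Saturated s → Star Arc v s → Arc s v → ∃ λ C → Covers C v
  unsaturatedConfig {v} {s} fixed sat w a
    with Isolated.extend sat (initial sat) (subst (Star Arc (σ s)) fixed (Star-σ w))
  ... | inj₁ (inj₂ h) = contradiction h (¬Hit sat)
  ... | inj₂ st = contradiction fixed (All.lookup (All.++⁺ saturated (sat ∷ []))
                    (subst (λ u → u ∈ A ++ s ∷ []) fixed (head∈ path)))
    where open Isolated.State sat st
  ... | inj₁ (inj₁ κ) = record
    { path = path ; capˡ = cap ; capʳ = stop fixed a ; regularˡ = regular
    ; regularʳ = proj₁ (proj₂ (Regular-++⁻ rˡ regular)) ; satˡ = saturated ; satʳ = [] }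
    , inj₂ (stopsAt fixed a)
    where open Isolated.Capped sat κ

-- Alternating cycles and their ears

module _ {A : Set} where

  nth : A → List A → ℕ → A
  nth d []       _       = d
  nth d (x ∷ xs) zero    = x
  nth d (x ∷ xs) (suc i) = nth d xs i

  nth-length : ∀ d xs → nth d xs (length xs) ≡ d
  nth-length d []       = refl
  nth-length d (x ∷ xs) = nth-length d xs

  nth-All : ∀ {P : A → Set} {d xs} → All P xs → ∀ {i} → i < length xs → P (nth d xs i)
  nth-All (p ∷ ps) {zero}  _       = p
  nth-All (p ∷ ps) {suc i} (s≤s l) = nth-All ps l

  nth-AllPairs : ∀ {R : Rel A 0ℓ} {d xs} → AllPairs R xs →
                 ∀ {i j} → i < j → j < length xs → R (nth d xs i) (nth d xs j)
  nth-AllPairs (r ∷ rs) {zero}  {suc j} _       (s≤s l) = nth-All r l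
  nth-AllPairs (r ∷ rs) {suc i} {suc j} (s≤s k) (s≤s l) = nth-AllPairs rs k l

∸-suc : ∀ {l i} → i < l → l ∸ i ≡ suc (l ∸ suc i)
∸-suc {suc l} {zero}  _       = refl
∸-suc {suc l} {suc i} (s≤s p) = ∸-suc p

module Cycles {n : ℕ} {G : Graph n} (S : Structure G) where
  open Structure S
  open Digraph S
  open Caps S
  open Search S
  open import Data.List.Membership.DecPropositional (_≟_ {n}) using (_∈?_)

  -- A regular closed path z 0 → z 1 → … → z l = z 0; on the underlying alternating cycle
  -- the vertices z i ("black") and σ (z i) ("white") alternate.
  record AltCycle (v : Fin n) : Set where
    field
      l      : ℕ
      z      : ℕ → Fin n
      positive : 0 < l
      start  : z 0 ≡ v
      end    : z l ≡ v
      arc    : ∀ {i} → i < l → Arc (z i) (z (suc i))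
      apart  : ∀ {i j} → i < j → j < l → Apart (z i) (z j)
      sat    : ∀ {i} → i < l → Saturated (z i)

    z-apart : ∀ {i j} → i ≢ j → i < l → j < l → Apart (z i) (z j)
    z-apart {i} {j} i≢j i<l j<l with <-cmp i j
    ... | tri< i<j _ _ = apart i<j j<l
    ... | tri≈ _ i≡j _ = contradiction i≡j i≢j
    ... | tri> _ _ j<i = Apart-sym (apart j<i i<l)

    start≡end : z 0 ≡ z l
    start≡end = trans start (sym end)

    z-apart′ : ∀ {i j} → i ≢ j → 0 < i → 0 < j → i ≤ l → j ≤ l → Apart (z i) (z j)
    z-apart′ {i} {j} i≢j 0<i 0<j i≤l j≤l with m≤n⇒m<n∨m≡n i≤l | m≤n⇒m<n∨m≡n j≤l
    ... | inj₁ i<l  | inj₁ j<l  = z-apart i≢j i<l j<l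
    ... | inj₂ refl | inj₁ j<l  = subst (λ u → Apart u (z j)) start≡end (apart 0<j j<l)
    ... | inj₁ i<l  | inj₂ refl = Apart-sym (subst (λ u → Apart u (z i)) start≡end (apart 0<i i<l))
    ... | inj₂ refl | inj₂ refl = contradiction refl i≢j

    reduce : ∀ {i} → i ≤ l → ∃ λ j → j < l × z i ≡ z j
    reduce i≤l with m≤n⇒m<n∨m≡n i≤l
    ... | inj₁ i<l  = _ , i<l , refl
    ... | inj₂ refl = 0 , positive , sym start≡end

    sat′ : ∀ {i} → i ≤ l → Saturated (z i)
    sat′ i≤l with reduce i≤l
    ... | j , j<l , e = subst Saturated (sym e) (sat j<l)

    white≢black : ∀ {i j} → i ≤ l → j ≤ l → σ (z i) ≢ z j
    white≢black i≤l j≤l e with reduce i≤l | reduce j≤l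
    ... | i , i<l , p | j , j<l , q with i ≟ℕ j | trans (cong σ (sym p)) (trans e q)
    ...   | yes refl | e′ = sat i<l e′
    ...   | no i≢j   | e′ = proj₂ (z-apart (i≢j ∘ sym) j<l i<l) (sym e′)

    predecessor : ∀ {i} → i < l → ∃ λ j → j < l × z i ≡ z (suc j)
    predecessor {suc j} j<l = j , <⇒≤ j<l , refl
    predecessor {zero}  0<l with l in eq
    ... | suc k = k , ≤-refl , trans start≡end (cong z eq)

    Off : Fin n → Set
    Off x = ∀ {i} → i ≤ l → x ≢ z i × x ≢ σ (z i)

    Off-σ : ∀ {x} → Off x → Off (σ x)
    Off-σ o i≤l = (λ e → proj₂ (o i≤l) (σ-swap′ e)) , λ e → proj₁ (o i≤l) (σ-injective e)

    data Colour (x : Fin n) : Set where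
      black : ∀ a → a < l → x ≡ z a → Colour x
      white : ∀ b → b < l → x ≡ σ (z b) → Colour x
      off   : Off x → Colour x

    colour : ∀ x → Colour x
    colour x with anyUpTo? (λ i → x ≟ z i) l | anyUpTo? (λ i → x ≟ σ (z i)) l
    ... | yes (a , a<l , e) | _                 = black a a<l e
    ... | no _              | yes (b , b<l , e) = white b b<l e
    ... | no ¬b             | no ¬w             = off λ i≤l → let j , j<l , e = reduce i≤l in
      (λ q → ¬b (j , j<l , trans q e)) , λ q → ¬w (j , j<l , trans q (cong σ e))

    -- The inner vertices of an ear from p to q are the listed vertices and their mates.
    data Ear (p q : Fin n) : List (Fin n) → Set where
      direct : E p q → Ear p q []
      via    : ∀ {h t ks} → E p (σ h) → Path h t ks → All Off ks → E t q → Ear p q ks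

    Ear-σ : ∀ {p q ks} → Ear p q ks → Ear q p (revσ ks)
    Ear-σ (direct e)       = direct (E-sym e)
    Ear-σ (via {t = t} e p o e′) =
      via (subst (E _) (sym (σσ t)) (E-sym e′)) (Path-σ p) (All-revσ Off-σ o) (E-sym e)

    Ear-off : ∀ {p q ks} → Ear p q ks → All Off ks
    Ear-off (direct _)     = []
    Ear-off (via _ _ os _) = os

    Simple : List (Fin n) → Set
    Simple ks = Regular ks × All Saturated ks

    Simple-revσ : ∀ {ks} → Simple ks → Simple (revσ ks)
    Simple-revσ (r , s) = Regular-revσ r , All-revσ Saturated-σ s

    -- An ear that returns to its starting vertex serves only as a walk and may repeat vertices; one
    -- with different ends may become part of a blossom in `Crossing` and must be simple.
    BlackEar : ℕ → ℕ → Set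
    BlackEar a b = ∃ λ ks → Ear (z a) (z b) ks × (a ≡ b ⊎ Simple ks)

    WhiteEar : ℕ → ℕ → Set
    WhiteEar c d = ∃ λ ks → Ear (σ (z c)) (σ (z d)) ks × (c ≡ d ⊎ Simple ks)

    BlackEar-sym : ∀ {a b} → BlackEar a b → BlackEar b a
    BlackEar-sym (ks , e , inj₁ eq) = revσ ks , Ear-σ e , inj₁ (sym eq)
    BlackEar-sym (ks , e , inj₂ s)  = revσ ks , Ear-σ e , inj₂ (Simple-revσ s)

    WhiteEar-sym : ∀ {a b} → WhiteEar a b → WhiteEar b a
    WhiteEar-sym (ks , e , inj₁ eq) = revσ ks , Ear-σ e , inj₁ (sym eq)
    WhiteEar-sym (ks , e , inj₂ s)  = revσ ks , Ear-σ e , inj₂ (Simple-revσ s)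

    -- What is known about a walk from x to a white vertex: it contains an ear with black ends, or
    -- before meeting the cycle in a white vertex it can be made regular or returns from x to σ x.
    data Tail (x : Fin n) : Set where
      found   : ∀ {a b} → a < l → b < l → BlackEar a b → Tail x
      arrived : ∀ {b} → b < l → x ≡ σ (z b) → Tail x
      simple  : ∀ {t ks b} → b < l → Path x t ks → All Off ks → Simple ks → E t (z b) → Tail x
      return  : ∀ {ks} → Path x (σ x) ks → All Off ks → Tail x

    -- A repetition of `x` is cut out. If the path meets `σ x`, or `x` is its own mate, this is
    -- impossible, and a return from `x` to `σ x` is recorded instead.
    prepend : ∀ {x y} → Off x → Arc x y → Tail y → Tail x
    prepend o a (found p q e) = found p q e
    prepend {x} o a (return {ks} p os) =
      return (a ∷ (p ▷ Arc-σ a ◁ ⟨ σ x ⟩)) (o ∷ All.++⁺ os (Off-σ o ∷ []))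
    prepend {x} o a (arrived {b} b<l refl) with σ x ≟ x
    ... | yes fixed = return (subst (λ u → Path x u _) (sym fixed) ⟨ x ⟩) (o ∷ [])
    ... | no s      = simple b<l ⟨ x ⟩ (o ∷ []) (Regular-[] , s ∷ []) (subst (E x) (σσ (z b)) (proj₁ a))
    prepend {x} o a (simple {t} {ks} b<l p os (r , ss) e) with σ x ≟ x
    ... | yes fixed = return (subst (λ u → Path x u _) (sym fixed) ⟨ x ⟩) (o ∷ [])
    ... | no s with x ∈? ks | σ x ∈? ks
    ... | yes i | _ with ∈-∃++ i
    ...   | A , B , refl =
      simple b<l (proj₂ (path-split A p)) (All.++⁻ʳ A os)
             (proj₁ (proj₂ (Regular-++⁻ A r)) , All.++⁻ʳ A ss) e
    prepend {x} o a (simple {t} {ks} b<l p os (r , ss) e) | no s | no i | yes j with ∈-∃++ j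
    ...   | A , B , refl = return (a ∷ path-prefix A p) (o ∷ All-prefix A os)
    prepend {x} o a (simple {t} {ks} b<l p os (r , ss) e) | no s | no i | no j =
      simple b<l (a ∷ p) (o ∷ os) (Regular-∷ (fresh i j) r , s ∷ ss) e

    depart : ∀ {x y a} → a < l → x ≡ z a → Arc x y → Tail y → Tail x
    depart a<l refl e (found p q ear) = found p q ear
    depart a<l refl e (arrived {b} b<l refl) =
      found a<l b<l ([] , direct (subst (E _) (σσ (z b)) (proj₁ e)) , inj₂ ([] , []))
    depart a<l refl e (simple b<l p os s e′) = found a<l b<l (_ , via (proj₁ e) p os e′ , inj₂ s)
    -- The edge by which the ear leaves `z a` ends at `σ y`, where the return arrives, so the same
    -- edge leads back to `z a`.
    depart a<l refl e (return p os) = found a<l a<l (_ , via (proj₁ e) p os (E-sym (proj₁ e)) , inj₁ refl)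

    tail : ∀ {x} → Star Arc x (σ (z 0)) → Tail x
    tail ε = arrived positive refl
    tail {x} (a ◅ w) with colour x
    ... | black i i<l e = depart i<l e a (tail w)
    ... | white b b<l e = arrived b<l e
    ... | off o         = prepend o a (tail w)

    -- The walk starts at a black vertex, which is neither white nor off the cycle; of the outcomes
    -- of `tail` only `found` is left.
    blackEar : Star Arc (z 0) (σ (z 0)) → ∃₂ λ a b → a < l × b < l × BlackEar a b
    blackEar w with tail w
    ... | found p q e = _ , _ , p , q , e
    ... | arrived {zero}  b<l e = contradiction (sym e) (sat positive)
    ... | arrived {suc b} b<l e = contradiction e (proj₂ (apart (s≤s z≤n) b<l))
    ... | simple _ p os _ _ = contradiction refl (proj₁ (All.lookup os (head∈ p) z≤n))
    ... | return p os       = contradiction refl (proj₁ (All.lookup os (head∈ p) z≤n))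

  path-arc : ∀ {x e d L} → Path x e L → Arc e d → ∀ {i} → i < length L →
             Arc (nth d L i) (nth d L (suc i))
  path-arc ⟨ _ ⟩           b {zero}  _       = b
  path-arc (a ∷ ⟨ _ ⟩)     b {zero}  _       = a
  path-arc (a ∷ (a′ ∷ p))  b {zero}  _       = a
  path-arc ⟨ _ ⟩           b {suc i} (s≤s ())
  path-arc (a ∷ p)         b {suc i} (s≤s q) = path-arc p b q

  fromClosedPath : ∀ {v} → ClosedPath v → AltCycle v
  fromClosedPath {v} P = record
    { l = length L ; z = nth v L ; positive = positive path ; start = start path ; end = nth-length v L
    ; arc = path-arc path closing ; apart = nth-AllPairs regular ; sat = nth-All saturated }
    where
    open ClosedPath P
    positive : ∀ {x y L} → Path x y L → 0 < length L
    positive ⟨ _ ⟩   = s≤s z≤n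
    positive (_ ∷ _) = s≤s z≤n
    start : ∀ {x y L} → Path x y L → nth v L 0 ≡ x
    start ⟨ _ ⟩   = refl
    start (_ ∷ _) = refl

  module _ {v : Fin n} (Z : AltCycle v) where
    open AltCycle Z

    -- The same cycle run through in the opposite direction: black and white are exchanged, so white
    -- ears are obtained as black ears of the dual.
    dual : AltCycle (σ v)
    dual = record
      { l = l ; z = λ i → σ (z (l ∸ i)) ; positive = positive
      ; start = cong σ end ; end = cong σ (trans (cong z (n∸n≡0 l)) start)
      ; arc = λ {i} i<l → Arc-σ (subst (λ k → Arc (z (l ∸ suc i)) (z k)) (sym (∸-suc i<l))
                            (arc (subst (_≤ l) (∸-suc i<l) (m∸n≤m l i))))
      ; apart = λ {i} {j} i<j j<l → Apart-σˡ (Apart-σʳ (z-apart′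
          (≢-sym (<⇒≢ (∸-monoʳ-< i<j (<⇒≤ j<l)))) (m<n⇒0<n∸m (≤-trans i<j (<⇒≤ j<l))) (m<n⇒0<n∸m j<l)
          (m∸n≤m l i) (m∸n≤m l j)))
      ; sat = λ {i} _ → Saturated-σ (sat′ (m∸n≤m l i)) }

    private module Dual = AltCycle dual

    -- White indices range from 1 to `l`, black ones from 0 to `l ∸ 1`. From `v` on the cycle reads
    -- `z 0`, `σ (z 1)`, `z 1`, up to `σ (z l)`; so `σ (z c)` precedes `z a` exactly if c ≤ a, and
    -- the order of the ends becomes a comparison of indices.
    whiteEar : Star Arc (σ (z 0)) (z 0) →
               ∃₂ λ c d → 0 < c × c ≤ l × 0 < d × d ≤ l × WhiteEar c d
    whiteEar w with Dual.blackEar (subst₂ (Star Arc) (cong σ start≡end)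
                                   (trans start≡end (sym (σσ (z l)))) w)
    ... | a , b , a<l , b<l , ks , e , s =
      l ∸ a , l ∸ b , m<n⇒0<n∸m a<l , m∸n≤m l a , m<n⇒0<n∸m b<l , m∸n≤m l b ,
      ks , ear e , loopOrSimple s
      where
      undual : ∀ {x} → Dual.Off x → Off x
      undual {x} o {i} i≤l =
        (λ q → proj₂ (o (m∸n≤m l i)) (trans q (trans (cong z (sym (m∸[m∸n]≡n i≤l))) (sym (σσ _))))) ,
        (λ q → proj₁ (o (m∸n≤m l i)) (trans q (cong (σ ∘ z) (sym (m∸[m∸n]≡n i≤l)))))
      ear : ∀ {p q ks} → Dual.Ear p q ks → Ear p q ks
      ear (Dual.direct e)       = direct e
      ear (Dual.via e p os e′) = via e p (All.map undual os) e′
      loopOrSimple : a ≡ b ⊎ Simple ks → l ∸ a ≡ l ∸ b ⊎ Simple ks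
      loopOrSimple (inj₁ refl) = inj₁ refl
      loopOrSimple (inj₂ s)    = inj₂ s

-- Exchanging matched and unmatched edges along an alternating cycle conjugates σ by the
-- rotation of the black vertices.
module Flip {n : ℕ} {G : Graph n} (S : Structure G) {v : Fin n} (Z : Cycles.AltCycle S v) where
  open Structure S
  open Digraph S
  open Cycles S
  open AltCycle Z

  next prev : Fin n → Fin n
  next x with anyUpTo? (λ i → x ≟ z i) l
  ... | yes (i , _) = z (suc i)
  ... | no _        = x
  prev x with anyUpTo? (λ i → x ≟ z (suc i)) l
  ... | yes (i , _) = z i
  ... | no _        = x

  next-black : ∀ {i} → i < l → next (z i) ≡ z (suc i)
  next-black {i} i<l with anyUpTo? (λ j → z i ≟ z j) l
  ... | no ¬p = contradiction (i , i<l , refl) ¬p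
  ... | yes (j , j<l , e) with i ≟ℕ j
  ...   | yes refl = refl
  ...   | no i≢j   = contradiction e (proj₁ (z-apart i≢j i<l j<l))

  prev-black : ∀ {i} → i < l → prev (z (suc i)) ≡ z i
  prev-black {i} i<l with anyUpTo? (λ j → z (suc i) ≟ z (suc j)) l
  ... | no ¬p = contradiction (i , i<l , refl) ¬p
  ... | yes (j , j<l , e) with i ≟ℕ j
  ...   | yes refl = refl
  ...   | no i≢j   = contradiction e (proj₁ (z-apart′ (i≢j ∘ suc-injective) (s≤s z≤n) (s≤s z≤n) i<l j<l))

  next-other : ∀ {x} → (∀ {i} → i ≤ l → x ≢ z i) → next x ≡ x
  next-other {x} ¬b with anyUpTo? (λ j → x ≟ z j) l
  ... | no _              = refl
  ... | yes (j , j<l , e) = contradiction e (¬b (<⇒≤ j<l))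

  prev-other : ∀ {x} → (∀ {i} → i ≤ l → x ≢ z i) → prev x ≡ x
  prev-other {x} ¬b with anyUpTo? (λ j → x ≟ z (suc j)) l
  ... | no _              = refl
  ... | yes (j , j<l , e) = contradiction e (¬b j<l)

  data View (x : Fin n) : Set where
    black : ∀ {i} → i < l → x ≡ z i → View x
    white : ∀ {i} → i < l → x ≡ σ (z (suc i)) → View x
    off   : Off x → View x

  view : ∀ x → View x
  view x with colour x
  ... | Colour.black a a<l e = black a<l e
  ... | Colour.off o = off o
  ... | Colour.white b b<l e with predecessor b<l
  ...   | j , j<l , e′ = white j<l (trans e (cong σ e′))

  σ′ : Fin n → Fin n
  σ′ x = prev (σ (next x))

  prev-next : ∀ x → prev (next x) ≡ x
  prev-next x with view x
  ... | black i<l refl = trans (cong prev (next-black i<l)) (prev-black i<l)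
  ... | white i<l refl = trans (cong prev (next-other (white≢black i<l))) (prev-other (white≢black i<l))
  ... | off o = trans (cong prev (next-other (proj₁ ∘ o))) (prev-other (proj₁ ∘ o))

  next-prev : ∀ x → next (prev x) ≡ x
  next-prev x with view x
  ... | white i<l refl = trans (cong next (prev-other (white≢black i<l))) (next-other (white≢black i<l))
  ... | off o = trans (cong next (prev-other (proj₁ ∘ o))) (next-other (proj₁ ∘ o))
  ... | black i<l refl with predecessor i<l
  ...   | j , j<l , e = trans (cong (next ∘ prev) e)
          (trans (cong next (prev-black j<l)) (trans (next-black j<l) (sym e)))

  σ′σ′ : ∀ x → σ′ (σ′ x) ≡ x
  σ′σ′ x = trans (cong (prev ∘ σ) (next-prev (σ (next x)))) (trans (cong prev (σσ (next x))) (prev-next x))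

  σ′-black : ∀ {i} → i < l → σ′ (z i) ≡ σ (z (suc i))
  σ′-black i<l = trans (cong (prev ∘ σ) (next-black i<l)) (prev-other (white≢black i<l))

  σ′-white : ∀ {i} → i < l → σ′ (σ (z (suc i))) ≡ z i
  σ′-white i<l = trans (cong (prev ∘ σ) (next-other (white≢black i<l))) (trans (cong prev (σσ _)) (prev-black i<l))

  σ′-off : ∀ {x} → Off x → σ′ x ≡ σ x
  σ′-off o = trans (cong (prev ∘ σ) (next-other (proj₁ ∘ o))) (prev-other (proj₁ ∘ Off-σ o))

  -- The new matching edges on the cycle are its former unmatched edges. The former matching edges
  -- may therefore be artificial, which `no-augmenting-path` exploits.
  flip-edge : (∀ {x} → Off x → Saturated x → E x (σ x)) → ∀ {x} → σ′ x ≢ x → E x (σ′ x)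
  flip-edge f {x} s with view x
  ... | black i<l refl = subst (E _) (sym (σ′-black i<l)) (proj₁ (arc i<l))
  ... | white i<l refl = subst (E _) (sym (σ′-white i<l)) (E-sym (proj₁ (arc i<l)))
  ... | off o = subst (E x) (sym (σ′-off o)) (f o (s ∘ trans (σ′-off o)))

  flip-fixed : ∀ {x} → σ′ x ≡ x → Off x × σ x ≡ x
  flip-fixed {x} e with view x
  ... | black i<l refl =
    contradiction (subst (E _) (trans (sym (σ′-black i<l)) e) (proj₁ (arc i<l))) E-irrefl
  ... | white {i} i<l refl =
    contradiction (subst (λ u → E u (σ (z (suc i)))) (trans (sym (σ′-white i<l)) e) (proj₁ (arc i<l))) E-irrefl
  ... | off o = o , trans (sym (σ′-off o)) e

  flipped : Structure G
  flipped = record { edgeList = edgeList ; E-sym = E-sym ; E⇒Adj = E⇒Adj ; σ = σ′ ; σσ = σ′σ′ }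

  private
    module D′ = Digraph flipped
    module C′ = Cycles flipped

  -- Former matching edges become the unmatched edges of the new arcs, hence the hypothesis. The
  -- arcs now lead from `z (suc k)` to `z k`, hence the index `l ∸ i`.
  flippedCycle : (∀ {x} → Saturated x → E x (σ x)) → C′.AltCycle v
  flippedCycle f = record
    { l = l ; z = λ i → z (l ∸ i) ; positive = positive ; start = end
    ; end = trans (cong z (n∸n≡0 l)) start
    ; arc = λ {i} i<l → subst (λ k → D′.Arc (z k) (z (l ∸ suc i))) (sym (∸-suc i<l))
        (back (subst (_≤ l) (∸-suc i<l) (m∸n≤m l i)))
    ; apart = λ {i} {j} i<j j<l → proj₁ (z-apart′
          (≢-sym (<⇒≢ (∸-monoʳ-< i<j (<⇒≤ j<l)))) (m<n⇒0<n∸m (≤-trans i<j (<⇒≤ j<l))) (m<n⇒0<n∸m j<l)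
          (m∸n≤m l i) (m∸n≤m l j)) , black≢σ′ (m∸n≤m l i) (m∸n≤m l j)
    ; sat = λ {i} i<l e → black≢σ′ (m∸n≤m l i) (m∸n≤m l i) (sym e) }
    where
    back : ∀ {k} → k < l → D′.Arc (z (suc k)) (z k)
    back k<l = subst (E _) (sym (σ′-black k<l)) (f (sat′ k<l)) , ≢-sym (proj₂ (arc k<l))
    black≢σ′ : ∀ {i j} → i ≤ l → j ≤ l → z i ≢ σ′ (z j)
    black≢σ′ i≤l j≤l e with reduce j≤l
    ... | j′ , j′<l , q =
      white≢black j′<l i≤l (sym (trans e (trans (cong σ′ q) (σ′-black j′<l))))

  module Transfer (f : ∀ {x} → Saturated x → E x (σ x)) where
    private module Z′ = C′.AltCycle (flippedCycle f)

    Off⇒Off′ : ∀ {x} → Off x → Z′.Off x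
    Off⇒Off′ {x} o {i} i≤l = proj₁ (o (m∸n≤m l i)) , notWhite
      where
      notWhite : x ≢ σ′ (z (l ∸ i))
      notWhite e with reduce (m∸n≤m l i)
      ... | j , j<l , q = proj₂ (o j<l) (trans e (trans (cong σ′ q) (σ′-black j<l)))

    Path⇒Path′ : ∀ {x y ks} → Path x y ks → All Off ks → D′.Path x y ks
    Path⇒Path′ ⟨ x ⟩ _ = D′.⟨ x ⟩
    Path⇒Path′ (a ∷ p) (_ ∷ os) =
      (subst (E _) (sym (σ′-off (All.lookup os (head∈ p)))) (proj₁ a) , proj₂ a) D′.∷ Path⇒Path′ p os

    ear : ∀ {p q ks} → Ear p q ks → Z′.Ear p q ks
    ear (direct e)     = Z′.direct e
    ear (via e p os e′) = Z′.via (subst (E _) (sym (σ′-off (All.lookup os (head∈ p)))) e)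
      (Path⇒Path′ p os) (All.map Off⇒Off′ os) e′

    simple′ : ∀ {ks} → All Off ks → Simple ks → Z′.Simple ks
    simple′ []       _                = [] , []
    simple′ (o ∷ os) (r ∷ rs , s ∷ ss) with simple′ os (rs , ss)
    ... | rs′ , ss′ =
      All.zipWith (λ (o′ , p , q) → p , q ∘ (λ e → trans e (σ′-off o′))) (os , r) ∷ rs′ ,
      (s ∘ trans (sym (σ′-off o))) ∷ ss′

    blackEar′ : ∀ {a b} → a ≤ l → b ≤ l → BlackEar a b → Z′.BlackEar (l ∸ a) (l ∸ b)
    blackEar′ {a} {b} a≤l b≤l (ks , e , s) =
      ks , subst₂ (λ i j → Z′.Ear (z i) (z j) ks) (sym (m∸[m∸n]≡n a≤l)) (sym (m∸[m∸n]≡n b≤l)) (ear e) ,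
      shape s
      where
      shape : a ≡ b ⊎ Simple ks → l ∸ a ≡ l ∸ b ⊎ Z′.Simple ks
      shape (inj₁ refl) = inj₁ refl
      shape (inj₂ s)    = inj₂ (simple′ (Ear-off e) s)

    -- The new mate of `z c` is `σ (z (suc c))`, so the white index `suc c` becomes `l ∸ c`, while a
    -- black index `a` becomes `l ∸ a`. This reverses the order of the ends as long as `z 0` is not
    -- among them.
    whiteEar′ : ∀ {c d} → c < l → d < l → WhiteEar (suc c) (suc d) → Z′.WhiteEar (l ∸ c) (l ∸ d)
    whiteEar′ {c} {d} c<l d<l (ks , e , s) =
      ks , subst₂ (λ x y → Z′.Ear x y ks) (sym (mate c<l)) (sym (mate d<l)) (ear e) , shape s
      where
      mate : ∀ {c} → c < l → σ′ (z (l ∸ (l ∸ c))) ≡ σ (z (suc c))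
      mate c<l = trans (cong (σ′ ∘ z) (m∸[m∸n]≡n (<⇒≤ c<l))) (σ′-black c<l)
      shape : suc c ≡ suc d ⊎ Simple ks → l ∸ c ≡ l ∸ d ⊎ Z′.Simple ks
      shape (inj₁ refl) = inj₁ refl
      shape (inj₂ s)    = inj₂ (simple′ (Ear-off e) s)

-- Not a field of `Structure`, since `Join.joined` makes mates of two vertices that need not be
-- adjacent.
Valid : ∀ {n} {G : Graph n} → Structure G → Set
Valid S = ∀ {x} → σ x ≢ x → E x (σ x)
  where open Structure S

-- Deleting an unmatched edge of the cycle

module Deletion {n : ℕ} {G : Graph n} (S : Structure G) {v : Fin n} (Z : Cycles.AltCycle S v)
                {t : ℕ} (t<l : t < Cycles.AltCycle.l Z) where
  open Structure S
  open Digraph S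
  open Cycles S
  open AltCycle Z

  Deleted : Fin n × Fin n → Set
  Deleted (x , y) = (x ≡ z t × y ≡ σ (z (suc t))) ⊎ (x ≡ σ (z (suc t)) × y ≡ z t)

  kept? : ∀ e → Dec (¬ Deleted e)
  kept? (x , y) = ¬? (((x ≟ z t) ×-dec (y ≟ σ (z (suc t)))) ⊎-dec ((x ≟ σ (z (suc t))) ×-dec (y ≟ z t)))

  edgeList′ : List (Fin n × Fin n)
  edgeList′ = filter kept? edgeList

  shorter : length edgeList′ < length edgeList
  shorter = filter-notAll kept? edgeList
    (Any.map (λ { refl k → k (inj₁ (refl , refl)) }) (proj₁ (arc t<l)))

  deleted : Structure G
  deleted = record
    { edgeList = edgeList′
    ; E-sym = λ {x} {y} e → let e′ , k = ∈-filter⁻ kept? {xs = edgeList} e in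
        ∈-filter⁺ kept? (E-sym e′) λ { (inj₁ (p , q)) → k (inj₂ (q , p)) ; (inj₂ (p , q)) → k (inj₁ (q , p)) }
    ; E⇒Adj = λ e → E⇒Adj (proj₁ (∈-filter⁻ kept? {xs = edgeList} e))
    ; σ = σ ; σσ = σσ }

  module D′ = Digraph deleted

  keep : ∀ {x y} → E x y → ¬ Deleted (x , y) → Structure.E deleted x y
  keep e k = ∈-filter⁺ kept? e k

  deletedValid : Valid S → Valid deleted
  deletedValid f s = keep (f s) λ
    { (inj₁ (refl , q)) → proj₂ (arc t<l) (σ-injective q)
    ; (inj₂ (refl , q)) → proj₂ (arc t<l) (sym (trans (sym (σσ _)) q)) }

  up : ∀ {i j} → i ≤ j → j ≤ l → (∀ {m} → i ≤ m → m < j → m ≢ t) → Star D′.Arc (z i) (z j)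
  up i≤j = go (≤⇒≤′ i≤j)
    where
    go : ∀ {i j} → i ≤′ j → j ≤ l → (∀ {m} → i ≤ m → m < j → m ≢ t) → Star D′.Arc (z i) (z j)
    go ≤′-refl _ _ = ε
    go {i} {suc j} (≤′-step p) j<l c =
      go p (<⇒≤ j<l) (λ q r → c q (m<n⇒m<1+n r)) ◅◅ (keep (proj₁ (arc j<l)) intact , proj₂ (arc j<l)) ◅ ε
      where
      intact : ¬ Deleted (z j , σ (z (suc j)))
      intact (inj₁ (e , _)) = proj₁ (z-apart (c (≤′⇒≤ p) ≤-refl) j<l t<l) e
      intact (inj₂ (e , _)) = white≢black t<l (<⇒≤ j<l) (sym e)

  before : ∀ {i j} → i ≤ j → j ≤ t → Star D′.Arc (z i) (z j)
  before i≤j j≤t = up i≤j (≤-trans j≤t (<⇒≤ t<l)) λ _ m<j → <⇒≢ (<-≤-trans m<j j≤t)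

  after : ∀ {i j} → t < i → i ≤ j → j ≤ l → Star D′.Arc (z i) (z j)
  after t<i i≤j j≤l = up i≤j j≤l λ i≤m _ → >⇒≢ (<-≤-trans t<i i≤m)

  before-σ : ∀ {i j} → i ≤ j → j ≤ t → Star D′.Arc (σ (z j)) (σ (z i))
  before-σ p q = D′.Star-σ (before p q)

  after-σ : ∀ {i j} → t < i → i ≤ j → j ≤ l → Star D′.Arc (σ (z j)) (σ (z i))
  after-σ p q r = D′.Star-σ (after p q r)

  keepOffˡ : ∀ {x y} → Off x → E x y → Structure.E deleted x y
  keepOffˡ o e = keep e λ { (inj₁ (p , _)) → proj₁ (o (<⇒≤ t<l)) p ; (inj₂ (p , _)) → proj₂ (o t<l) p }

  keepOffʳ : ∀ {x y} → Off y → E x y → Structure.E deleted x y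
  keepOffʳ o e = keep e λ { (inj₁ (_ , p)) → proj₂ (o t<l) p ; (inj₂ (_ , p)) → proj₁ (o (<⇒≤ t<l)) p }

  offStar : ∀ {x y ks} → Path x y ks → All Off ks → Star D′.Arc x y
  offStar ⟨ _ ⟩   _        = ε
  offStar (a ∷ p) (o ∷ os) = (keepOffˡ o (proj₁ a) , proj₂ a) ◅ offStar p os

  black-ear : ∀ {a b} → a ≤ l → b ≤ l → BlackEar a b → Star D′.Arc (z a) (σ (z b))
  black-ear {a} {b} a≤l b≤l (_ , direct e , _) =
    (subst (Structure.E deleted _) (sym (σσ _))
      (keep e λ { (inj₁ (_ , p)) → white≢black t<l b≤l (sym p) ; (inj₂ (p , _)) → white≢black t<l a≤l (sym p) })
    , λ p → white≢black b≤l a≤l (sym p)) ◅ ε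
  black-ear {a} {b} a≤l b≤l (_ , via e p os e′ , _) =
    (keepOffʳ (Off-σ o) e , λ q → proj₁ (o a≤l) (sym q)) ◅ offStar p os
      ◅◅ (subst (Structure.E deleted _) (sym (σσ _)) (keepOffˡ o′ e′) , proj₂ (o′ b≤l)) ◅ ε
    where
    o = All.lookup os (head∈ p)
    o′ = All.lookup os (last∈ p)

  white-ear : ∀ {c d} → c ≤ l → d ≤ l → WhiteEar c d → Star D′.Arc (σ (z c)) (z d)
  white-ear {a} {b} a≤l b≤l (_ , direct e , _) =
    (keep e (λ { (inj₁ (p , _)) → white≢black a≤l (<⇒≤ t<l) p ; (inj₂ (_ , p)) → white≢black b≤l (<⇒≤ t<l) p })
    , white≢black a≤l b≤l) ◅ ε
  white-ear {a} {b} a≤l b≤l (_ , via e p os e′ , _) =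
    (keepOffʳ (Off-σ o) e , λ q → proj₂ (o a≤l) (sym q)) ◅ offStar p os
      ◅◅ (keepOffˡ o′ e′ , proj₁ (o′ b≤l)) ◅ ε
    where
    o = All.lookup os (head∈ p)
    o′ = All.lookup os (last∈ p)

module _ {n : ℕ} {G : Graph n} where

  open Structure

  -- By `fixed` no saturated vertex becomes unsaturated: `v` stays saturated for the induction, and
  -- the matching found at the end is still maximum.
  record Reduction (S : Structure G) (v : Fin n) : Set where
    field
      S′      : Structure G
      valid   : Valid S′
      shorter : length (edgeList S′) < length (edgeList S)
      fixed   : ∀ {x} → σ S′ x ≡ x → σ S x ≡ x
      to      : Star (Digraph.Arc S′) v (σ S′ v)
      from    : Star (Digraph.Arc S′) (σ S′ v) v

  record Solution (S : Structure G) (v : Fin n) : Set where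
    field
      S′     : Structure G
      valid  : Valid S′
      fixed  : ∀ {x} → σ S′ x ≡ x → σ S x ≡ x
      config : Caps.Config S′
      covers : Search.Covers S′ config v

module Ears {n : ℕ} {G : Graph n} (S : Structure G) (valid : Valid S) {v : Fin n}
            (Z : Cycles.AltCycle S v) where
  open Structure S
  open Digraph S
  open Caps S
  open Search S
  open Cycles S
  open AltCycle Z

  module _ {t : ℕ} (t<l : t < l) where
    open Deletion S Z t<l

    reduction : Star D′.Arc (z 0) (σ (z 0)) → Star D′.Arc (σ (z l)) (z l) → Reduction S v
    reduction p q = record
      { S′ = deleted ; valid = deletedValid valid ; shorter = shorter ; fixed = λ e → e
      ; to = subst (λ u → Star D′.Arc u (σ u)) start p
      ; from = subst (λ u → Star D′.Arc (σ u) u) end q }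

  -- The names give the colours of the ends of the two ears in the order in which they occur on the
  -- cycle from v on. The deleted edge follows z b in the first two cases and z a in the third.
  reduce-bbww : ∀ {a b c d} → a ≤ b → b < l → b < c → c ≤ l → b < d → d ≤ l →
                BlackEar a b → WhiteEar c d → Reduction S v
  reduce-bbww a≤b b<l b<c c≤l b<d d≤l K Q = reduction b<l
    (before z≤n a≤b ◅◅ black-ear (≤-trans a≤b (<⇒≤ b<l)) (<⇒≤ b<l) K ◅◅ before-σ z≤n ≤-refl)
    (after-σ b<d d≤l ≤-refl ◅◅ white-ear d≤l c≤l (WhiteEar-sym Q) ◅◅ after b<c c≤l ≤-refl)
    where open Deletion S Z b<l

  -- The deletion separates `z c` from `z l`. The black ear turns the walk round: it comes over the
  -- white ear to `z c`, passes the black ear, and goes back over the white ear in the other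
  -- direction.
  reduce-wbbw : ∀ {a b c d} → a ≤ b → b < l → c ≤ a → b < d → d ≤ l →
                BlackEar a b → WhiteEar c d → Reduction S v
  reduce-wbbw a≤b b<l c≤a b<d d≤l K Q = reduction b<l
    (before z≤n a≤b ◅◅ black-ear a≤l (<⇒≤ b<l) K ◅◅ before-σ z≤n ≤-refl)
    (after-σ b<d d≤l ≤-refl ◅◅ white-ear d≤l c≤l (WhiteEar-sym Q) ◅◅ before c≤a a≤b
      ◅◅ black-ear a≤l (<⇒≤ b<l) K ◅◅ before-σ (≤-trans c≤a a≤b) ≤-refl
      ◅◅ white-ear c≤l d≤l Q ◅◅ after b<d d≤l ≤-refl)
    where
    open Deletion S Z b<l
    a≤l = ≤-trans a≤b (<⇒≤ b<l)
    c≤l = ≤-trans c≤a a≤l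

  -- Here it is the walk to `σ v` that has to turn: it uses the black ear in both directions, with
  -- the white ear in between.
  reduce-bwwb : ∀ {a b c d} → b < l → a < c → c ≤ b → a < d → d ≤ b →
                BlackEar a b → WhiteEar c d → Reduction S v
  reduce-bwwb b<l a<c c≤b a<d d≤b K Q = reduction a<l
    (before z≤n ≤-refl ◅◅ black-ear (<⇒≤ a<l) b≤l K ◅◅ after-σ a<d d≤b b≤l
      ◅◅ white-ear d≤l c≤l (WhiteEar-sym Q) ◅◅ after a<c c≤b b≤l
      ◅◅ black-ear b≤l (<⇒≤ a<l) (BlackEar-sym K) ◅◅ before-σ z≤n ≤-refl)
    (after-σ a<d d≤l ≤-refl ◅◅ white-ear d≤l c≤l (WhiteEar-sym Q) ◅◅ after a<c c≤l ≤-refl)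
    where
    b≤l = <⇒≤ b<l
    c≤l = ≤-trans c≤b b≤l
    d≤l = ≤-trans d≤b b≤l
    a<l = <-≤-trans a<c c≤l
    open Deletion S Z a<l

-- Crossing ears

module Crossing {n : ℕ} {G : Graph n} (S : Structure G) {v : Fin n} (Z : Cycles.AltCycle S v) where
  open Structure S
  open Digraph S
  open Caps S
  open Search S
  open Cycles S
  open AltCycle Z

  record Segment (i j : ℕ) : Set where
    field
      {xs}    : List (Fin n)
      path    : Path (z i) (z j) xs
      within  : ∀ {x} → x ∈ xs → ∃ λ k → i ≤ k × k ≤ j × x ≡ z k
      regular : Regular xs
      sat     : All Saturated xs

  segment : ∀ {i j} → i ≤ j → j < l → Segment i j
  segment i≤j = go (≤⇒≤′ i≤j)
    where
    go : ∀ {i j} → i ≤′ j → j < l → Segment i j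
    go {i} ≤′-refl i<l = record
      { path = ⟨ z i ⟩ ; within = λ { (here refl) → i , ≤-refl , ≤-refl , refl }
      ; regular = Regular-[] ; sat = sat i<l ∷ [] }
    go {i} {suc j} (≤′-step p) j<l = record
      { path = Segment.path s ▷ arc (<⇒≤ j<l) ◁ ⟨ z (suc j) ⟩
      ; within = within
      ; regular = Regular-++⁺ (Segment.regular s) Regular-[] apart′
      ; sat = All.++⁺ (Segment.sat s) (sat j<l ∷ []) }
      where
      s = go p (<⇒≤ j<l)
      within : ∀ {x} → x ∈ Segment.xs s ++ z (suc j) ∷ [] → ∃ λ k → i ≤ k × k ≤ suc j × x ≡ z k
      within x∈ with ∈-++⁻ (Segment.xs s) x∈
      ... | inj₂ (here refl) = suc j , ≤′⇒≤ (≤′-step p) , ≤-refl , refl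
      ... | inj₁ x∈′ with Segment.within s x∈′
      ...   | k , i≤k , k≤j , e = k , i≤k , m≤n⇒m≤1+n k≤j , e
      apart′ : Segment.xs s ∥ z (suc j) ∷ []
      apart′ x∈ (here refl) with Segment.within s x∈
      ... | k , _ , k≤j , refl = apart (s≤s k≤j) j<l

  -- The last edge of the ear, into `q`, and the matching edge at `q` form an arc to `σ q`. The
  -- inequalities make sure that the end edges of the ear are unmatched.
  ear-path : ∀ {p q ks t xs} → Ear p q ks → p ≢ σ q → (∀ {x} → Off x → x ≢ p × x ≢ σ q) →
             Path (σ q) t xs → ∃ λ h → Arc p h × Path h t (ks ++ xs)
  ear-path {q = q} (direct e) p≢ _ path = σ q , (subst (E _) (sym (σσ q)) e , p≢) , path
  ear-path {q = q} (via e p os e′) _ ne path =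
    _ , (e , ≢-sym (proj₁ (ne (All.lookup os (head∈ p))))) ,
    p ▷ subst (E _) (sym (σσ q)) e′ , proj₂ (ne (All.lookup os (last∈ p))) ◁ path

  module _ {a b c : ℕ} (a<c : a < c) (c≤b : c ≤ b) (b<l : b < l) where

    private
      a<b = <-≤-trans a<c c≤b
      a<l = ≤-<-trans (<⇒≤ a<b) b<l

    -- The stretch of the cycle from `z d` on through `v` to `z a`, which will join the bases of the
    -- two blossoms.
    record Stem (d : ℕ) : Set where
      field
        {D}     : List (Fin n)
        path    : Path (z d) (z a) D
        within  : ∀ {x} → x ∈ D → ∃ λ k → (k ≤ a ⊎ d ≤ k × k < l) × x ≡ z k
        regular : Regular D
        sat     : All Saturated D
        covers  : v ∈ D

    stem : ∀ {d} → b < d → d ≤ l → Stem d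
    stem {d} b<d d≤l with m≤n⇒m<n∨m≡n d≤l
    -- Here `z d` is `z l`, which is `v` again, so the stretch is just the segment from `z 0` to
    -- `z a`.
    ... | inj₂ refl = record
      { path = subst (λ u → Path u (z a) s₁.xs) start≡end s₁.path
      ; within = λ x∈ → let k , _ , k≤a , e = s₁.within x∈ in k , inj₁ k≤a , e
      ; regular = s₁.regular ; sat = s₁.sat ; covers = subst (_∈ s₁.xs) start (head∈ s₁.path) }
      where module s₁ = Segment (segment z≤n a<l)
    ... | inj₁ d<l = go (pred l) (suc-pred l {{>-nonZero positive}})
      where
      module s₁ = Segment (segment z≤n a<l)
      go : ∀ m → suc m ≡ l → Stem d
      go m sm≡l = record
        { path = s₂.path ▷ subst (Arc (z m)) (trans (cong z sm≡l) (sym start≡end)) (arc m<l) ◁ s₁.path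
        ; within = within ; regular = Regular-++⁺ s₂.regular s₁.regular apart′
        ; sat = All.++⁺ s₂.sat s₁.sat ; covers = ∈-++⁺ʳ s₂.xs (subst (_∈ s₁.xs) start (head∈ s₁.path)) }
        where
        m<l : m < l
        m<l = subst (m <_) sm≡l ≤-refl
        module s₂ = Segment (segment (≤-pred (subst (d <_) (sym sm≡l) d<l)) m<l)
        within : ∀ {x} → x ∈ s₂.xs ++ s₁.xs → ∃ λ k → (k ≤ a ⊎ d ≤ k × k < l) × x ≡ z k
        within x∈ with ∈-++⁻ s₂.xs x∈
        ... | inj₁ i = let k , d≤k , k≤m , e = s₂.within i in k , inj₂ (d≤k , ≤-<-trans k≤m m<l) , e
        ... | inj₂ i = let k , _ , k≤a , e = s₁.within i in k , inj₁ k≤a , e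
        apart′ : s₂.xs ∥ s₁.xs
        apart′ x∈ y∈ with s₂.within x∈ | s₁.within y∈
        ... | k , d≤k , k≤m , refl | k′ , _ , k′≤a , refl =
          z-apart (>⇒≢ (≤-<-trans k′≤a (<-trans a<b (<-≤-trans b<d d≤k)))) (≤-<-trans k≤m m<l) (≤-<-trans k′≤a a<l)

    off∥ : ∀ {ks xs} → All Off ks → (∀ {x} → x ∈ xs → ∃ λ k → k ≤ l × x ≡ z k) → ks ∥ xs
    off∥ os w x∈ y∈ with w y∈
    ... | k , k≤l , refl = All.lookup os x∈ k≤l

    inStem : ∀ {d} (s : Stem d) {x} → x ∈ Stem.D s → ∃ λ k → k ≤ l × x ≡ z k
    inStem s x∈ with Stem.within s x∈
    ... | k , inj₁ k≤a       , e = k , <⇒≤ (≤-<-trans k≤a a<l) , e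
    ... | k , inj₂ (_ , k<l) , e = k , <⇒≤ k<l , e

    -- The two blossoms share the part of the cycle between c and b, and the ears may intersect;
    -- only the path joining the bases has to avoid the blossoms.
    crossing : ∀ {d} → b < d → d ≤ l → BlackEar a b → WhiteEar c d → ∃ λ C → Covers C v
    crossing _ _ (_ , _ , inj₁ a≡b) _ = contradiction a≡b (<⇒≢ a<b)
    crossing b<d _ _ (_ , _ , inj₁ c≡d) = contradiction c≡d (<⇒≢ (≤-<-trans c≤b b<d))
    crossing {suc d} b<d d<l (ks , K , inj₂ (rK , sK)) Q@(_ , _ , inj₂ _) with WhiteEar-sym Q
    ... | _ , _ , inj₁ d≡c = contradiction d≡c (>⇒≢ (≤-<-trans c≤b b<d))
    ... | qs , Q′ , inj₂ (rQ , sQ) = record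
      { path = s.path
      ; capˡ = let _ , e , p = left in
          loop e p (subst (Arc (z d)) (sym (σσ _)) (arc d<l))
      ; capʳ = let _ , e , p = right in loop e p (Arc-σ (arc a<l))
      ; regularˡ = Regular-++⁺ (Regular-++⁺ rQ sˡ.regular (off∥ (Ear-off Q′) inˡ)) s.regular
          (∥-++ qs (off∥ (Ear-off Q′) (inStem s₀)) left∥)
      ; regularʳ = Regular-++⁺ (Regular-++⁺ rK (Regular-revσ sʳ.regular) (∥-revσ (off∥ (Ear-off K) inʳ))) s.regular
          (∥-++ ks (off∥ (Ear-off K) (inStem s₀)) (∥-sym (∥-revσ right∥)))
      ; satˡ = All.++⁺ (All.++⁺ sQ sˡ.sat) s.sat
      ; satʳ = All.++⁺ sK (All-revσ Saturated-σ sʳ.sat) }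
      , inj₁ (inj₁ (∈-++⁺ʳ (qs ++ sˡ.xs) s.covers))
      where
      s₀ = stem b<d d<l
      module s = Stem s₀
      c≤d : c ≤ d
      c≤d = ≤-trans c≤b (≤-pred b<d)
      module sˡ = Segment (segment c≤d d<l)
      module sʳ = Segment (segment {suc a} {b} a<b b<l)
      inˡ : ∀ {x} → x ∈ sˡ.xs → ∃ λ k → k ≤ l × x ≡ z k
      inˡ x∈ = let k , _ , k≤d , e = sˡ.within x∈ in k , ≤-trans k≤d (<⇒≤ d<l) , e
      inʳ : ∀ {x} → x ∈ sʳ.xs → ∃ λ k → k ≤ l × x ≡ z k
      inʳ x∈ = let k , _ , k≤b , e = sʳ.within x∈ in k , ≤-trans k≤b (<⇒≤ b<l) , e
      c≤l = ≤-trans c≤d (<⇒≤ d<l)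
      -- The blossom with base `σ (z (suc d))`: the white ear to `σ (z c)`, then the cycle from
      -- `z c` up to `z d`. Its counterpart `right` has base `z a`, follows the black ear to `z b`,
      -- and returns from `σ (z b)` to `σ (z (suc a))`.
      left : ∃ λ h → Arc (σ (z (suc d))) h × Path h (z d) (qs ++ sˡ.xs)
      left = ear-path Q′
        (λ e → white≢black d<l c≤l (trans e (σσ _)))
        (λ o → proj₂ (o d<l) , λ e → proj₁ (o c≤l) (trans e (σσ _)))
        (subst (λ u → Path u (z d) sˡ.xs) (sym (σσ _)) sˡ.path)
      right : ∃ λ h → Arc (z a) h × Path h (σ (z (suc a))) (ks ++ revσ sʳ.xs)
      right = ear-path K (λ e → white≢black (<⇒≤ b<l) (<⇒≤ a<l) (sym e))
        (λ o → proj₁ (o (<⇒≤ a<l)) , proj₂ (o (<⇒≤ b<l)))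
        (Path-σ sʳ.path)
      left∥ : sˡ.xs ∥ s.D
      left∥ x∈ y∈ with sˡ.within x∈ | s.within y∈
      ... | k , c≤k , k≤d , refl | k′ , inj₁ k′≤a , refl =
        z-apart (>⇒≢ (≤-<-trans k′≤a (<-≤-trans a<c c≤k))) (≤-<-trans k≤d d<l) (≤-<-trans k′≤a a<l)
      ... | k , c≤k , k≤d , refl | k′ , inj₂ (d<k′ , k′<l) , refl =
        z-apart (<⇒≢ (≤-<-trans k≤d d<k′)) (≤-<-trans k≤d d<l) k′<l
      right∥ : s.D ∥ sʳ.xs
      right∥ y∈ x∈ with sʳ.within x∈ | s.within y∈
      ... | k , a<k , k≤b , refl | k′ , inj₁ k′≤a , refl =
        z-apart (<⇒≢ (≤-<-trans k′≤a a<k)) (≤-<-trans k′≤a a<l) (≤-<-trans k≤b b<l)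
      ... | k , a<k , k≤b , refl | k′ , inj₂ (d<k′ , k′<l) , refl =
        z-apart (>⇒≢ (≤-<-trans k≤b (<-≤-trans b<d d<k′))) k′<l (≤-<-trans k≤b b<l)

-- Induction on the number of edges

module Resolve {n : ℕ} {G : Graph n} where
  open Structure


  flip-solution : ∀ {S : Structure G} {v} (Z : Cycles.AltCycle S v) →
                  Solution (Flip.flipped S Z) v → Solution S v
  flip-solution {S} Z s = record
    { S′ = S′ ; valid = valid ; fixed = λ e → proj₂ (Flip.flip-fixed S Z (fixed e)) ; config = config ; covers = covers }
    where open Solution s

  flip-reduction : ∀ {S : Structure G} {v} (Z : Cycles.AltCycle S v) →
                   Reduction (Flip.flipped S Z) v → Reduction S v
  flip-reduction {S} Z s = record
    { S′ = S′ ; valid = valid ; shorter = shorter ; fixed = λ e → proj₂ (Flip.flip-fixed S Z (fixed e)) ; to = to ; from = from }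
    where open Reduction s

  module _ (S : Structure G) (valid : Valid S) {v : Fin n} (Z : Cycles.AltCycle S v) where
    open Cycles.AltCycle Z

    private
      module F = Flip S Z
      module T = F.Transfer valid

    S′ : Structure G
    S′ = F.flipped
    valid′ : Valid S′
    valid′ = F.flip-edge (λ _ → valid)
    Z′ : Cycles.AltCycle S′ v
    Z′ = F.flippedCycle valid

    -- Of the six orders of the ends, three allow a deletion and bwbw is the crossing. The other
    -- two, wwbb and wbwb, turn into bbww and bwbw when the matching is switched; in both `a` is
    -- positive, so the reversal affects all four ends.
    resolve-sorted : ∀ {a b c d} → a ≤ b → b < l → c ≤ d → 0 < c → d ≤ l →
                     BlackEar a b → WhiteEar c d → Reduction S v ⊎ Solution S v
    resolve-sorted {a} {b} {suc c} {suc d} a≤b b<l c≤d _ d≤l K Q with suc c ≤? a | suc d ≤? b | suc d ≤? a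
    ... | no c≰a | no d≰b | _ with suc c ≤? b
    ...   | no c≰b = inj₁ (Ears.reduce-bbww S valid Z a≤b b<l (≰⇒> c≰b) (≤-trans c≤d d≤l) (≰⇒> d≰b) d≤l K Q)
    ...   | yes c≤b = inj₂ record
      { S′ = S ; valid = valid ; fixed = λ e → e ; config = proj₁ C ; covers = proj₂ C }
      where C = Crossing.crossing S Z (≰⇒> c≰a) c≤b b<l (≰⇒> d≰b) d≤l K Q
    resolve-sorted a≤b b<l c≤d _ d≤l K Q | no c≰a | yes d≤b | _ =
      inj₁ (Ears.reduce-bwwb S valid Z b<l (≰⇒> c≰a) (≤-trans c≤d d≤b) (<-≤-trans (≰⇒> c≰a) c≤d) d≤b K Q)
    resolve-sorted a≤b b<l c≤d _ d≤l K Q | yes c≤a | no d≰b | _ =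
      inj₁ (Ears.reduce-wbbw S valid Z a≤b b<l c≤a (≰⇒> d≰b) d≤l K Q)
    resolve-sorted {a} {b} {suc c} {suc d} a≤b b<l c≤d _ d≤l K Q | yes c≤a | yes d≤b | yes d≤a =
      inj₁ (flip-reduction Z (Ears.reduce-bbww S′ valid′ Z′
        (∸-monoʳ-≤ l a≤b) (∸-monoʳ-< (<-≤-trans (s≤s z≤n) c≤a) a≤l)
        (∸-monoʳ-< d≤a a≤l) (m∸n≤m l d) (∸-monoʳ-< c≤a a≤l) (m∸n≤m l c)
        (Cycles.AltCycle.BlackEar-sym Z′ (T.blackEar′ a≤l (<⇒≤ b<l) K))
        (Cycles.AltCycle.WhiteEar-sym Z′ (T.whiteEar′ (≤-trans c≤d d≤l) d≤l Q))))
      where a≤l = ≤-trans a≤b (<⇒≤ b<l)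
    resolve-sorted {a} {b} {suc c} {suc d} a≤b b<l c≤d _ d≤l K Q | yes c≤a | yes d≤b | no d≰a =
      inj₂ (flip-solution Z record
        { S′ = S′ ; valid = valid′ ; fixed = λ e → e ; config = proj₁ C ; covers = proj₂ C })
      where
      a≤l = ≤-trans a≤b (<⇒≤ b<l)
      C = Crossing.crossing S′ Z′ (∸-monoʳ-< d≤b (<⇒≤ b<l)) (∸-monoʳ-≤ l (≤-pred (≰⇒> d≰a)))
            (∸-monoʳ-< (<-≤-trans (s≤s z≤n) c≤a) a≤l) (∸-monoʳ-< c≤a a≤l) (m∸n≤m l c)
            (Cycles.AltCycle.BlackEar-sym Z′ (T.blackEar′ a≤l (<⇒≤ b<l) K))
            (Cycles.AltCycle.WhiteEar-sym Z′ (T.whiteEar′ (≤-trans c≤d d≤l) d≤l Q))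

    resolve : ∀ {a b c d} → a < l → b < l → 0 < c → c ≤ l → 0 < d → d ≤ l →
              BlackEar a b → WhiteEar c d → Reduction S v ⊎ Solution S v
    resolve {a} {b} {c} {d} a<l b<l 0<c c≤l 0<d d≤l K Q with ≤-total a b | ≤-total c d
    ... | inj₁ p | inj₁ q = resolve-sorted p b<l q 0<c d≤l K Q
    ... | inj₁ p | inj₂ q = resolve-sorted p b<l q 0<d c≤l K (WhiteEar-sym Q)
    ... | inj₂ p | inj₁ q = resolve-sorted p a<l q 0<c d≤l (BlackEar-sym K) Q
    ... | inj₂ p | inj₂ q = resolve-sorted p a<l q 0<d c≤l (BlackEar-sym K) (WhiteEar-sym Q)

  solve : ∀ (S : Structure G) → Acc _<_ (length (edgeList S)) → Valid S → ∀ {v} → σ S v ≢ v →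
          Star (Digraph.Arc S) v (σ S v) → Star (Digraph.Arc S) (σ S v) v → Solution S v
  solve S (acc rec) valid {v} sat to from with Search.configOrCycle S sat to from
  ... | inj₁ (C , covers) = record { S′ = S ; valid = valid ; fixed = λ e → e ; config = C ; covers = covers }
  -- The closed path starts at `σ v`; its dual has `v` as the black starting vertex.
  ... | inj₂ P = onCycle (subst (Cycles.AltCycle S) (σσ S v) (Cycles.dual S (Cycles.fromClosedPath S P)))
    where
    onCycle : Cycles.AltCycle S v → Solution S v
    onCycle Z with blackEar (subst (λ u → Star (Digraph.Arc S) u (σ S u)) (sym start) to)
                 | Cycles.whiteEar S Z (subst (λ u → Star (Digraph.Arc S) (σ S u) u) (sym start) from)
      where open Cycles.AltCycle Z
    ... | a , b , a<l , b<l , K | c , d , 0<c , c≤l , 0<d , d≤l , Q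
      with resolve S valid Z a<l b<l 0<c c≤l 0<d d≤l K Q
    ... | inj₂ s = s
    ... | inj₁ r = record
      { S′ = Solution.S′ s ; valid = Solution.valid s ; fixed = λ e → Reduction.fixed r (Solution.fixed s e)
      ; config = Solution.config s ; covers = Solution.covers s }
      where
      s : Solution (Reduction.S′ r) v
      s = solve (Reduction.S′ r) (rec (Reduction.shorter r)) (Reduction.valid r)
            (λ e → sat (Reduction.fixed r e)) (Reduction.to r) (Reduction.from r)

-- Maximum matchings

injection-length : ∀ {A B : Set} (f : A → B) {xs ys} → Unique xs → (∀ {x} → x ∈ xs → f x ∈ ys) →
                   (∀ {x y} → x ∈ xs → y ∈ xs → f x ≡ f y → x ≡ y) → length xs ≤ length ys
injection-length f {[]}     _        _ _   = z≤n
injection-length f {x ∷ xs} (n ∷ u) m inj with ∈-∃++ (m (here refl))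
... | as , bs , refl = subst (suc (length xs) ≤_) (sym (trans (length-++ as) (+-suc (length as) (length bs))))
  (s≤s (subst (length xs ≤_) (length-++ as)
    (injection-length f u into λ x∈ y∈ → inj (there x∈) (there y∈))))
  where
  into : ∀ {y} → y ∈ xs → f y ∈ as ++ bs
  into y∈ with ∈-++⁻ as (m (there y∈))
  ... | inj₁ i         = ∈-++⁺ˡ i
  ... | inj₂ (there i) = ∈-++⁺ʳ as i
  ... | inj₂ (here e)  = contradiction (inj (here refl) (there y∈) (sym e)) (All.lookup n y∈)

length-doubled : ∀ {A : Set} (xs : List A) → length (cartesianProduct (true ∷ false ∷ []) xs) ≡ 2 * length xs
length-doubled {A} xs = trans (length-++ (map (tag true) xs)) (cong₂ _+_ (length-map (tag true) xs)
  (trans (length-++ (map (tag false) xs)) (cong (_+ 0) (length-map (tag false) xs))))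
  where
  tag : Bool → A → Bool × A
  tag b x = b , x

module _ {n : ℕ} {G : Graph n} where
  open Graph G

  module Mates (M : Matching G) where
    open Matching M

    mate? : ∀ u → Dec (∃ λ v → Mem u v)
    mate? u = any? (λ v → T? (mem u v))

    saturatedVertices : List (Fin n)
    saturatedVertices = filter mate? (allFin n)

    matched? : ∀ e → Dec (proj₁ e <ᶠ proj₂ e × Mem (proj₁ e) (proj₂ e))
    matched? (u , v) = (u <ᶠ? v) ×-dec T? (mem u v)

    matchingEdges : List (Fin n × Fin n)
    matchingEdges = filter matched? (cartesianProduct (allFin n) (allFin n))

    -- Each matching edge occurs once for each of its ends. These entries correspond to the
    -- saturated vertices, whose number is therefore twice the size.
    endpoints : List (Bool × Fin n × Fin n)
    endpoints = cartesianProduct (true ∷ false ∷ []) matchingEdges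

    endpoint : Bool × Fin n × Fin n → Fin n
    endpoint (b , u , v) = if b then u else v

    matched : ∀ {b u v} → (b , u , v) ∈ endpoints → u <ᶠ v × Mem u v
    matched i = proj₂ (∈-filter⁻ matched? {xs = cartesianProduct (allFin n) (allFin n)}
                        (proj₂ (∈-cartesianProduct⁻ (true ∷ false ∷ []) matchingEdges i)))

    endpoint-injective : ∀ {x y} → x ∈ endpoints → y ∈ endpoints → endpoint x ≡ endpoint y → x ≡ y
    endpoint-injective {true , u , v} {true , u′ , v′} p q refl with matched p | matched q
    ... | _ , a | _ , b with refl ← nonadjacent a b = refl
    endpoint-injective {false , u , v} {false , u′ , v′} p q refl with matched p | matched q
    ... | _ , a | _ , b with refl ← nonadjacent (mem-sym a) (mem-sym b) = refl
    endpoint-injective {true , u , v} {false , u′ , v′} p q refl with matched p | matched q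
    ... | l , a | l′ , b with refl ← nonadjacent a (mem-sym b) = contradiction l′ (<ᶠ-asym l)
    endpoint-injective {false , u , v} {true , u′ , v′} p q refl with matched p | matched q
    ... | l , a | l′ , b with refl ← nonadjacent (mem-sym a) b = contradiction l′ (<ᶠ-asym l)

    endpoint-saturated : ∀ {x} → x ∈ endpoints → endpoint x ∈ saturatedVertices
    endpoint-saturated {true , u , v}  p = ∈-filter⁺ mate? (∈-allFin u) (v , proj₂ (matched p))
    endpoint-saturated {false , u , v} p = ∈-filter⁺ mate? (∈-allFin v) (u , mem-sym (proj₂ (matched p)))

    edgeAt : Fin n → Bool × Fin n × Fin n
    edgeAt u with mate? u
    -- A placeholder with the right endpoint, so that `endpoint-edgeAt` holds for every vertex.
    ... | no _ = true , u , u
    ... | yes (v , _) = if ⌊ u <ᶠ? v ⌋ then (true , u , v) else (false , v , u)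

    endpoint-edgeAt : ∀ u → endpoint (edgeAt u) ≡ u
    endpoint-edgeAt u with mate? u
    ... | no _ = refl
    ... | yes (v , _) with u <ᶠ? v
    ...   | yes _ = refl
    ...   | no _  = refl

    edgeAt-∈ : ∀ {u} → u ∈ saturatedVertices → edgeAt u ∈ endpoints
    edgeAt-∈ {u} u∈ with mate? u | proj₂ (∈-filter⁻ mate? {xs = allFin n} u∈)
    ... | no ¬p | p = contradiction p ¬p
    ... | yes (v , a) | _ with u <ᶠ? v
    ...   | yes u<v = ∈-cartesianProduct⁺ {xs = true ∷ false ∷ []} {ys = matchingEdges} (here refl)
              (∈-filter⁺ matched? (∈-cartesianProduct⁺ (∈-allFin u) (∈-allFin v)) (u<v , a))
    ...   | no u≮v with <ᶠ-cmp u v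
    ...     | tri< u<v _ _ = contradiction u<v u≮v
    ...     | tri≈ _ refl _ = contradiction (mem⇒adj a) (adj-irrefl refl)
    ...     | tri> _ _ v<u = ∈-cartesianProduct⁺ {xs = true ∷ false ∷ []} {ys = matchingEdges} (there (here refl))
              (∈-filter⁺ matched? (∈-cartesianProduct⁺ (∈-allFin v) (∈-allFin u)) (v<u , mem-sym a))

    endpoints-length : length endpoints ≡ 2 * size
    endpoints-length = length-doubled matchingEdges

    saturatedVertices-unique : Unique saturatedVertices
    saturatedVertices-unique = Unique.filter⁺ mate? (Unique.allFin⁺ n)

    size≤ : 2 * size ≤ length saturatedVertices
    size≤ = subst (_≤ length saturatedVertices) endpoints-length
      (injection-length endpoint
        (Unique.cartesianProduct⁺ (((λ ()) ∷ []) ∷ [] ∷ [])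
          (Unique.filter⁺ matched? (Unique.cartesianProduct⁺ (Unique.allFin⁺ n) (Unique.allFin⁺ n))))
        endpoint-saturated endpoint-injective)

    ≤size : length saturatedVertices ≤ 2 * size
    ≤size = subst (length saturatedVertices ≤_) endpoints-length
      (injection-length edgeAt saturatedVertices-unique edgeAt-∈
        λ {x} {y} _ _ e → trans (sym (endpoint-edgeAt x)) (trans (cong endpoint e) (endpoint-edgeAt y)))

  module _ (M M′ : Matching G)
           (unsat : ∀ {u} → Matching.Unsaturated M′ u → Matching.Unsaturated M u) where
    private
      module A = Mates M
      module B = Mates M′

    saturated-⊆ : ∀ {u} → u ∈ A.saturatedVertices → u ∈ B.saturatedVertices
    saturated-⊆ {u} u∈ with B.mate? u
    ... | yes p = ∈-filter⁺ B.mate? (∈-allFin u) p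
    ... | no ¬p with proj₂ (∈-filter⁻ A.mate? {xs = allFin n} u∈)
    ...   | v , a = contradiction a (unsat (λ v b → ¬p (v , b)) v)

    -- Sizes are compared through the sets of saturated vertices, so a change that loses none of
    -- these keeps a matching maximum.
    size-mono : Matching.size M ≤ Matching.size M′
    size-mono = *-cancelˡ-≤ 2 (≤-trans A.size≤ (≤-trans
      (injection-length (λ u → u) A.saturatedVertices-unique saturated-⊆ λ _ _ e → e) B.≤size))

    size-strict : ∀ {u v} → Matching.Unsaturated M u → Matching.Mem M′ u v → Matching.size M < Matching.size M′
    size-strict {u} {v} p m = *-cancelˡ-< 2 _ _ (≤-trans (s≤s A.size≤) (≤-trans
      (injection-length (λ u → u) (All.tabulate new ∷ A.saturatedVertices-unique) into λ _ _ e → e) B.≤size))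
      where
      new : ∀ {w} → w ∈ A.saturatedVertices → u ≢ w
      new w∈ refl with proj₂ (∈-filter⁻ A.mate? {xs = allFin n} w∈)
      ... | v , a = p v a
      into : ∀ {w} → w ∈ u ∷ A.saturatedVertices → w ∈ B.saturatedVertices
      into (here refl) = ∈-filter⁺ B.mate? (∈-allFin u) (v , m)
      into (there w∈)  = saturated-⊆ w∈

  toMatching : (S : Structure G) → Valid S → Matching G
  toMatching S valid = record
    { mem = λ u v → ⌊ matched? u v ⌋
    ; mem-sym = λ {u} {v} m → let e , ne = toWitness {a? = matched? u v} m in
        fromWitness (trans (cong σ (sym e)) (σσ u) , ≢-sym ne)
    ; mem⇒adj = λ {u} {v} m → let e , ne = toWitness {a? = matched? u v} m in
        E⇒Adj (subst (E u) e (valid (λ q → ne (trans (sym q) e))))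
    ; nonadjacent = λ {u} {v} {w} m m′ →
        trans (sym (proj₁ (toWitness {a? = matched? u v} m))) (proj₁ (toWitness {a? = matched? u w} m′)) }
    where
    open Structure S
    matched? : ∀ u v → Dec (σ u ≡ v × u ≢ v)
    matched? u v = (σ u ≟ v) ×-dec ¬? (u ≟ v)

  module _ (S : Structure G) (valid : Valid S) where
    open Structure S
    open Matching (toMatching S valid)

    Mem⁺ : ∀ {u v} → σ u ≡ v → u ≢ v → Mem u v
    Mem⁺ e ne = fromWitness (e , ne)

    Mem⁻ : ∀ {u v} → Mem u v → σ u ≡ v × u ≢ v
    Mem⁻ {u} {v} m = toWitness {a? = (σ u ≟ v) ×-dec ¬? (u ≟ v)} m

    fixed⇒unsaturated : ∀ {u} → σ u ≡ u → Unsaturated u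
    fixed⇒unsaturated e v m with Mem⁻ m
    ... | p , q = q (trans (sym e) p)

    unsaturated⇒fixed : ∀ {u} → Unsaturated u → σ u ≡ u
    unsaturated⇒fixed {u} f with σ u ≟ u
    ... | yes e = e
    ... | no ne = contradiction (Mem⁺ refl (≢-sym ne)) (f (σ u))

  fromMatching : Matching G → Structure G
  fromMatching M = record
    { edgeList = filter adj? (cartesianProduct (allFin n) (allFin n))
    ; E-sym = λ {x} {y} e → ∈-filter⁺ adj? (∈-cartesianProduct⁺ (∈-allFin y) (∈-allFin x))
        (adj-sym (proj₂ (∈-filter⁻ adj? {xs = cartesianProduct (allFin n) (allFin n)} e)))
    ; E⇒Adj = λ e → proj₂ (∈-filter⁻ adj? {xs = cartesianProduct (allFin n) (allFin n)} e)
    ; σ = mate ; σσ = mate-involutive }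
    where
    open Matching M
    open Mates M
    adj? : ∀ e → Dec (Adj (proj₁ e) (proj₂ e))
    adj? (x , y) = T? (adj x y)
    mate : Fin n → Fin n
    mate u with mate? u
    ... | yes (v , _) = v
    ... | no _        = u
    mate-involutive : ∀ u → mate (mate u) ≡ u
    mate-involutive u with mate? u in eq
    ... | no _ rewrite eq = refl
    ... | yes (v , a) with mate? v
    ...   | yes (w , b) = nonadjacent b (mem-sym a)
    ...   | no ¬p       = contradiction (u , mem-sym a) ¬p

  module _ (M : Matching G) where
    open Matching M
    open Mates M
    open Structure (fromMatching M)

    E⁺ : ∀ {x y} → Adj x y → E x y
    E⁺ {x} {y} a = ∈-filter⁺ _ (∈-cartesianProduct⁺ (∈-allFin x) (∈-allFin y)) a

    Mem⇒σ : ∀ {u v} → Mem u v → σ u ≡ v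
    Mem⇒σ {u} {v} a with mate? u
    ... | yes (w , b) = nonadjacent b a
    ... | no ¬p       = contradiction (v , a) ¬p

    σ⇒Mem : ∀ {u} → σ u ≢ u → Mem u (σ u)
    σ⇒Mem {u} ne with mate? u
    ... | yes (v , a) = a
    ... | no _        = contradiction refl ne

    unsaturated⇒σ : ∀ {u} → Unsaturated u → σ u ≡ u
    unsaturated⇒σ {u} f with mate? u
    ... | yes (v , a) = contradiction a (f v)
    ... | no _        = refl

    σ⇒unsaturated : ∀ {u} → σ u ≡ u → Unsaturated u
    σ⇒unsaturated e v a = adj-irrefl (trans (sym e) (Mem⇒σ a)) (mem⇒adj a)

    fromMatching-valid : Valid (fromMatching M)
    fromMatching-valid ne = E⁺ (mem⇒adj (σ⇒Mem ne))

-- Flowers and T-posies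

double-suc : ∀ k → 2 * suc k ≡ suc (suc (2 * k))
double-suc k = cong suc (+-suc k (k + 0))

start∈ : ∀ {A : Set} {R : Rel A 0ℓ} {u v} (w : Star R u v) → u ∈ vertices w
start∈ ε       = here refl
start∈ (_ ◅ _) = here refl

end∈ : ∀ {A : Set} {R : Rel A 0ℓ} {u v} (w : Star R u v) → v ∈ vertices w
end∈ ε       = here refl
end∈ (_ ◅ w) = there (end∈ w)

endpoints-∈ : ∀ {n} {G : Graph n} (C : Cycle G) {u v} → Cycle.HasEdge C u v → u ∈ Cycle.cycleVertices C
endpoints-∈ {G = G} C = λ { (inj₁ i) → proj₁ (ends i) ; (inj₂ i) → proj₂ (ends i) }
  where
  open Cycle C
  along : ∀ {u v x y} (w : Walk G u v) → (x , y) ∈ edges w → x ∈ vertices w × y ∈ vertices w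
  along (_ ◅ w) (here refl) = here refl , there (start∈ w)
  along (_ ◅ w) (there i)   = let p , q = along w i in there p , there q
  ends : ∀ {x y} → (x , y) ∈ cycleEdges → x ∈ cycleVertices × y ∈ cycleVertices
  ends (here refl) = end∈ path , start∈ path
  ends (there i)   = along path i

module Realize {n : ℕ} {G : Graph n} (S : Structure G) (valid : Valid S) where
  open Graph G
  open Structure S
  open Digraph S
  open Caps S
  open Search S

  M : Matching G
  M = toMatching S valid

  open Matching M

  -- The order in which the walk in `G` meets the vertices: each vertex of the path is entered
  -- through its mate.
  flat : List (Fin n) → List (Fin n)
  flat []       = []
  flat (x ∷ xs) = σ x ∷ x ∷ flat xs

  Meets : List (Fin n) → Fin n → Set
  Meets xs v = v ∈ xs ⊎ σ v ∈ xs

  ∈-flat⁻ : ∀ xs {y} → y ∈ flat xs → Meets xs y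
  ∈-flat⁻ (x ∷ xs) (here refl)         = inj₂ (here (σσ x))
  ∈-flat⁻ (x ∷ xs) (there (here refl)) = inj₁ (here refl)
  ∈-flat⁻ (x ∷ xs) (there (there i)) with ∈-flat⁻ xs i
  ... | inj₁ j = inj₁ (there j)
  ... | inj₂ j = inj₂ (there j)

  ∈-flat⁺ : ∀ {xs y} → Meets xs y → y ∈ flat xs
  ∈-flat⁺ (inj₁ (here refl)) = there (here refl)
  ∈-flat⁺ (inj₁ (there i))   = there (there (∈-flat⁺ (inj₁ i)))
  ∈-flat⁺ (inj₂ (here refl)) = here (sym (σσ _))
  ∈-flat⁺ (inj₂ (there i))   = there (there (∈-flat⁺ (inj₂ i)))

  apart-flat : ∀ {x xs} → (∀ {y} → y ∈ xs → Apart x y) → ∀ {y} → y ∈ flat xs → x ≢ y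
  apart-flat {xs = xs} f y∈ with ∈-flat⁻ xs y∈
  ... | inj₁ i = proj₁ (f i)
  ... | inj₂ i = λ e → proj₂ (f i) (trans e (sym (σσ _)))

  flat-unique : ∀ {xs} → Regular xs → All Saturated xs → Unique (flat xs)
  flat-unique []       []       = []
  flat-unique (a ∷ as) (s ∷ ss) =
    (s ∷ All.tabulate (apart-flat (Apart-σˡ ∘ All.lookup a))) ∷
    All.tabulate (apart-flat (All.lookup a)) ∷ flat-unique as ss

  ∥-flat : ∀ {x xs ys} → xs ∥ ys → x ∈ flat xs → x ∉ flat ys
  ∥-flat {xs = xs} p x∈ y∈ with ∈-flat⁻ xs x∈
  ... | inj₁ i = apart-flat (p i) y∈ refl
  ... | inj₂ i = apart-flat (λ j → subst (λ u → Apart u _) (σσ _) (Apart-σˡ (p i j))) y∈ refl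

  saturated-flat : ∀ {x xs} → All Saturated xs → x ∈ flat xs → Saturated x
  saturated-flat {xs = xs} s x∈ with ∈-flat⁻ xs x∈
  ... | inj₁ i = All.lookup s i
  ... | inj₂ i = λ e → All.lookup s i (cong σ e)

  matched : ∀ {x} → Saturated x → Mem (σ x) x
  matched s = Mem⁺ S valid (σσ _) s

  unmatched : ∀ {x y} → Arc x y → ¬ Mem x (σ y)
  unmatched a m = proj₂ a (σ-injective (proj₁ (Mem⁻ S valid m)))

  matched-adj : ∀ {x} → Saturated x → Adj (σ x) x
  matched-adj = mem⇒adj ∘ matched

  unmatched-adj : ∀ {x y} → Arc x y → Adj x (σ y)
  unmatched-adj = E⇒Adj ∘ proj₁

  -- Starting at `σ x` rather than `x` makes the first edge a matching edge and puts the start at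
  -- the base `σ c` of the left cap.
  mmWalk : ∀ {x y D} → Path x y D → All Saturated D → Walk G (σ x) y
  mmWalk ⟨ x ⟩   (s ∷ []) = matched-adj s ◅ ε
  mmWalk (a ∷ p) (s ∷ ss) = matched-adj s ◅ unmatched-adj a ◅ mmWalk p ss

  mmWalk-vertices : ∀ {x y D} (p : Path x y D) (ss : All Saturated D) → vertices (mmWalk p ss) ≡ flat D
  mmWalk-vertices ⟨ x ⟩   (s ∷ []) = refl
  mmWalk-vertices (a ∷ p) (s ∷ ss) = cong (λ l → _ ∷ _ ∷ l) (mmWalk-vertices p ss)

  mmWalk-length : ∀ {x y D} (p : Path x y D) (ss : All Saturated D) → suc ∥ mmWalk p ss ∥ ≡ 2 * length D
  mmWalk-length ⟨ x ⟩           (s ∷ []) = refl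
  mmWalk-length (_∷_ {xs = xs} a p) (s ∷ ss) =
    trans (cong (λ k → suc (suc k)) (mmWalk-length p ss)) (sym (double-suc (length xs)))

  inM? : ∀ e → Dec (InM M e)
  inM? (u , v) = T? (mem u v)

  mmWalk-matched : ∀ {x y D} (p : Path x y D) (ss : All Saturated D) →
                   length (filter inM? (edges (mmWalk p ss))) ≡ length D
  mmWalk-matched ⟨ x ⟩   (s ∷ []) = cong length (filter-accept inM? {xs = []} (matched s))
  mmWalk-matched (_∷_ {y = z} a p) (s ∷ ss) = trans
    (cong length (filter-accept inM? {xs = _ ∷ edges (mmWalk p ss)} (matched s)))
    (cong suc (trans (cong length (filter-reject inM? {xs = edges (mmWalk p ss)} (unmatched a)))
                     (mmWalk-matched p ss)))

  mmWalk-alternating : ∀ {x y D} (p : Path x y D) (ss : All Saturated D) → Alternating M (mmWalk p ss)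
  mmWalk-alternating ⟨ x ⟩ (s ∷ []) = [-]
  mmWalk-alternating (a ∷ ⟨ z ⟩) (s ∷ s′ ∷ []) =
    inj₁ (matched s , unmatched a) ∷ inj₂ (unmatched a , matched s′) ∷ [-]
  mmWalk-alternating (a ∷ p@(_ ∷ _)) (s ∷ ss@(s′ ∷ _)) =
    inj₁ (matched s , unmatched a) ∷ inj₂ (unmatched a , matched s′) ∷ mmWalk-alternating p ss

  mmWalk-head : ∀ {x y D} (p : Path x y D) (ss : All Saturated D) → AnyMaybe (InM M) (head (edges (mmWalk p ss)))
  mmWalk-head ⟨ x ⟩   (s ∷ []) = just (matched s)
  mmWalk-head (a ∷ p) (s ∷ ss) = just (matched s)

  mmWalk-last : ∀ {x y D} (p : Path x y D) (ss : All Saturated D) → AnyMaybe (InM M) (last (edges (mmWalk p ss)))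
  mmWalk-last ⟨ x ⟩ (s ∷ []) = just (matched s)
  mmWalk-last (a ∷ ⟨ z ⟩) (s ∷ s′ ∷ []) = just (matched s′)
  mmWalk-last (a ∷ p@(_ ∷ _)) (s ∷ ss@(_ ∷ _)) = mmWalk-last p ss

  stemWalk : ∀ {x s y D} → Path x s D → All Saturated D → σ y ≡ y → Arc s y → Walk G (σ x) y
  stemWalk ⟨ x ⟩   (s ∷ []) e b = matched-adj s ◅ subst (Adj x) e (unmatched-adj b) ◅ ε
  stemWalk (a ∷ p) (s ∷ ss) e b = matched-adj s ◅ unmatched-adj a ◅ stemWalk p ss e b

  stemWalk-vertices : ∀ {x s y D} (p : Path x s D) (ss : All Saturated D) (e : σ y ≡ y) (b : Arc s y) →
                      vertices (stemWalk p ss e b) ≡ flat D ++ y ∷ []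
  stemWalk-vertices ⟨ x ⟩   (s ∷ []) e b = refl
  stemWalk-vertices (a ∷ p) (s ∷ ss) e b = cong (λ l → _ ∷ _ ∷ l) (stemWalk-vertices p ss e b)

  stemWalk-length : ∀ {x s y D} (p : Path x s D) (ss : All Saturated D) (e : σ y ≡ y) (b : Arc s y) →
                    ∥ stemWalk p ss e b ∥ ≡ 2 * length D
  stemWalk-length ⟨ x ⟩   (s ∷ []) e b = refl
  stemWalk-length (_∷_ {xs = xs} a p) (s ∷ ss) e b =
    trans (cong (λ k → suc (suc k)) (stemWalk-length p ss e b)) (sym (double-suc (length xs)))

  stemWalk-alternating : ∀ {x s y D} (p : Path x s D) (ss : All Saturated D) (e : σ y ≡ y) (b : Arc s y) →
                         Alternating M (stemWalk p ss e b)
  stemWalk-alternating ⟨ x ⟩ (s ∷ []) e b =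
    inj₁ (matched s , unmatched b ∘ subst (Mem x) (sym e)) ∷ [-]
  stemWalk-alternating (a ∷ ⟨ z ⟩) (s ∷ s′ ∷ []) e b =
    inj₁ (matched s , unmatched a) ∷ inj₂ (unmatched a , matched s′) ∷
    stemWalk-alternating ⟨ z ⟩ (s′ ∷ []) e b
  stemWalk-alternating (a ∷ p@(_ ∷ _)) (s ∷ ss@(s′ ∷ _)) e b =
    inj₁ (matched s , unmatched a) ∷ inj₂ (unmatched a , matched s′) ∷ stemWalk-alternating p ss e b

  module _ {s h t : Fin n} {r : List (Fin n)} (a : Arc s h) (p : Path h t r) (b : Arc t (σ s))
           (reg : Regular r) (sat : All Saturated r) (apart : ∀ {y} → y ∈ r → Apart s y) where

    private
      w : Walk G s t
      w = unmatched-adj a ◅ mmWalk p sat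
      w-vertices : vertices w ≡ s ∷ flat r
      w-vertices = cong (s ∷_) (mmWalk-vertices p sat)
      b-unmatched : ¬ Mem t s
      b-unmatched m = unmatched b (subst (Mem t) (sym (σσ s)) m)

    blossom-length : length ((t , s) ∷ edges w) ≡ suc (2 * length r)
    blossom-length = cong suc (mmWalk-length p sat)

    blossom : Blossom M
    blossom = record
      { cycle = record
        { path = w
        ; isPath = subst Unique (sym w-vertices) (All.tabulate (apart-flat apart) ∷ flat-unique reg sat)
        ; closing = subst (Adj t) (σσ s) (unmatched-adj b)
        ; length≥3 = subst (3 ≤_) (sym blossom-length) (long p) }
      ; k = length r
      ; oddLength = blossom-length
      ; kMatched = trans (cong length (filter-reject inM? {xs = edges w} b-unmatched))
          (trans (cong length (filter-reject inM? {xs = edges (mmWalk p sat)} (unmatched a)))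
                 (mmWalk-matched p sat)) }
      where
      long : ∀ {h t r} → Path h t r → 3 ≤ suc (2 * length r)
      long ⟨ _ ⟩   = s≤s (s≤s (s≤s z≤n))
      long (_∷_ {xs = xs} _ _) = subst (λ k → 3 ≤ suc k) (sym (double-suc (length xs))) (s≤s (s≤s (s≤s z≤n)))

    blossom-vertices⁻ : ∀ {x} → x ∈ Blossom.cycleVertices blossom → x ≡ s ⊎ x ∈ flat r
    blossom-vertices⁻ {x} i with subst (x ∈_) w-vertices i
    ... | here e  = inj₁ e
    ... | there j = inj₂ j

    blossom-vertices⁺ : ∀ {x} → x ≡ s ⊎ Meets r x → x ∈ Blossom.cycleVertices blossom
    blossom-vertices⁺ (inj₁ e) = here e
    blossom-vertices⁺ {x} (inj₂ m) = subst (x ∈_) (sym w-vertices) (there (∈-flat⁺ m))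

    blossom-base : Blossom.IsBase blossom s
    blossom-base = here refl , λ u∈ m → notMatched (blossom-vertices⁻ u∈) (Mem⁻ S valid m)
      where
      notMatched : ∀ {u} → u ≡ s ⊎ u ∈ flat r → σ s ≡ u × s ≢ u → ⊥
      notMatched (inj₁ e) (_ , ne) = ne (sym e)
      notMatched (inj₂ i) (e , _)  = apart-flat (Apart-σˡ ∘ apart) i e

  Meets-++ : ∀ xs {ys v} → Meets (xs ++ ys) v → Meets xs v ⊎ Meets ys v
  Meets-++ xs (inj₁ i) with ∈-++⁻ xs i
  ... | inj₁ j = inj₁ (inj₁ j)
  ... | inj₂ j = inj₂ (inj₁ j)
  Meets-++ xs (inj₂ i) with ∈-++⁻ xs i
  ... | inj₁ j = inj₁ (inj₂ j)
  ... | inj₂ j = inj₂ (inj₂ j)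

  Meets-revσ : ∀ {xs v} → Meets xs v → Meets (revσ xs) v
  Meets-revσ {v = v} (inj₁ i) = inj₂ (∈-revσ⁺ (subst (_∈ _) (sym (σσ v)) i))
  Meets-revσ (inj₂ i) = inj₁ (∈-revσ⁺ i)

  tposy : ∀ {c s D rˡ rʳ h t h′ t′} → Path c s D →
          Arc (σ c) h → Path h t rˡ → Arc t (σ (σ c)) →
          Arc s h′ → Path h′ t′ rʳ → Arc t′ (σ s) →
          Regular (rˡ ++ D) → Regular (rʳ ++ D) → All Saturated (rˡ ++ D) → All Saturated rʳ →
          ∀ {v} → Meets (rˡ ++ D) v → Σ[ P ∈ Tposy M ] Tposy.Contains P v
  tposy {c} {s} {D} {rˡ} {rʳ} p a q b a′ q′ b′ regˡ regʳ satˡ satʳ {v} m = record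
    { posy = record
      { blossom₁ = B₁ ; blossom₂ = B₂
      -- If the cycles agreed, the base `σ c` would lie on the second blossom; but that blossom
      -- meets the connecting path only in `s`, which is not `σ c`.
      ; distinct = λ same → base-∉ (blossom-vertices⁻ a′ q′ b′ (proj₁ rʳs) satʳ apartʳ
          (endpoints-∈ (Blossom.cycle B₂) (Equivalence.to (same (σ c) _) (inj₁ (there (here refl))))))
      ; isBase₁ = blossom-base a q b (proj₁ rˡs) satˡ′ apartˡ
      ; isBase₂ = blossom-base a′ q′ b′ (proj₁ rʳs) satʳ apartʳ
      ; path = W ; isPath = subst Unique (sym (mmWalk-vertices p satD)) (flat-unique (proj₁ (proj₂ rˡs)) satD)
      ; path-mm = mmWalk-alternating p satD , mmWalk-head p satD , mmWalk-last p satD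
      ; path-odd = odd }
    ; internallyDisjoint = λ {x} x∈ x≢₁ x≢₂ →
        let x∈D = subst (x ∈_) (mmWalk-vertices p satD) x∈ in
        (λ i → outside x≢₁ (proj₂ (proj₂ rˡs)) x∈D (blossom-vertices⁻ a q b (proj₁ rˡs) satˡ′ apartˡ i)) ,
        (λ i → outside x≢₂ (proj₂ (proj₂ rʳs)) x∈D (blossom-vertices⁻ a′ q′ b′ (proj₁ rʳs) satʳ apartʳ i)) }
    , contains (Meets-++ rˡ m)
    where
    rˡs = Regular-++⁻ rˡ regˡ
    rʳs = Regular-++⁻ rʳ regʳ
    satˡ′ = All.++⁻ˡ rˡ satˡ
    satD = All.++⁻ʳ rˡ satˡ
    apartˡ : ∀ {y} → y ∈ rˡ → Apart (σ c) y
    apartˡ y∈ = Apart-σˡ (Apart-sym (proj₂ (proj₂ rˡs) y∈ (head∈ p)))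
    apartʳ : ∀ {y} → y ∈ rʳ → Apart s y
    apartʳ y∈ = Apart-sym (proj₂ (proj₂ rʳs) y∈ (last∈ p))
    B₁ = blossom a q b (proj₁ rˡs) satˡ′ apartˡ
    B₂ = blossom a′ q′ b′ (proj₁ rʳs) satʳ apartʳ
    W = mmWalk p satD
    base-∉ : ¬ (σ c ≡ s ⊎ σ c ∈ flat rʳ)
    base-∉ (inj₂ i) = ∥-flat (proj₂ (proj₂ rʳs)) i (∈-flat⁺ (inj₂ (subst (_∈ D) (sym (σσ c)) (head∈ p))))
    base-∉ (inj₁ e) = same-ends p (proj₁ (proj₂ rˡs)) satD e
      where
      same-ends : ∀ {c s D} → Path c s D → Regular D → All Saturated D → σ c ≢ s
      same-ends ⟨ _ ⟩   _       (s ∷ _) e = s e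
      same-ends (_ ∷ p) (r ∷ _) _       e = proj₂ (All.lookup r (last∈ p)) (trans (sym (σσ _)) (cong σ e))
    odd : 2 ∤ ∥ W ∥
    odd d = <-irrefl refl (∣⇒≤ (∣m+n∣m⇒∣n
      (subst (2 ∣_) (trans (sym (mmWalk-length p satD)) (+-comm 1 ∥ W ∥)) (m∣m*n (length D))) d))
    outside : ∀ {x y r} → x ≢ y → r ∥ D → x ∈ flat D → ¬ (x ≡ y ⊎ x ∈ flat r)
    outside ne _  _  (inj₁ e) = ne e
    outside _  ap i (inj₂ j) = ∥-flat ap j i
    contains : Meets rˡ v ⊎ Meets D v → _
    contains (inj₁ i) = inj₁ (blossom-vertices⁺ a q b (proj₁ rˡs) satˡ′ apartˡ (inj₂ i))
    contains (inj₂ i) = inj₂ (inj₂ (subst (v ∈_) (sym (mmWalk-vertices p satD)) (∈-flat⁺ i)))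

  flower : ∀ {c s D r h t y} → Path c s D → Arc (σ c) h → Path h t r → Arc t (σ (σ c)) →
           σ y ≡ y → Arc s y → Regular (r ++ D) → All Saturated (r ++ D) →
           ∀ {v} → Meets (r ++ D) v ⊎ v ≡ y → Σ[ F ∈ Flower M ] Flower.Contains F v
  flower {c} {s} {D} {r} {y = y} p a q b fixed e reg sat {v} m = record
    { blossom = blossom a q b (proj₁ rs) satʳ apart
    ; isBase = blossom-base a q b (proj₁ rs) satʳ apart
    ; end-unsaturated = fixed⇒unsaturated S valid fixed
    ; stem = W
    ; stem-path = subst Unique (sym (stemWalk-vertices p satD fixed e)) (snoc (flat-unique (proj₁ (proj₂ rs)) satD)
                    λ i → saturated-flat satD i fixed)
    ; stem-alt = stemWalk-alternating p satD fixed e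
    ; stem-even = subst (2 ∣_) (sym (stemWalk-length p satD fixed e)) (m∣m*n (length D))
    ; onlyBaseShared = λ {x} i j → shared (blossom-vertices⁻ a q b (proj₁ rs) satʳ apart i)
        (∈-++⁻ (flat D) (subst (x ∈_) (stemWalk-vertices p satD fixed e) j)) }
    , contains m
    where
    rs = Regular-++⁻ r reg
    satʳ = All.++⁻ˡ r sat
    satD = All.++⁻ʳ r sat
    W = stemWalk p satD fixed e
    apart : ∀ {y} → y ∈ r → Apart (σ c) y
    apart y∈ = Apart-σˡ (Apart-sym (proj₂ (proj₂ rs) y∈ (head∈ p)))
    snoc : ∀ {xs} → Unique xs → y ∉ xs → Unique (xs ++ y ∷ [])
    snoc []       n = [] ∷ []
    snoc (u ∷ us) n = All.++⁺ u ((λ { refl → n (here refl) }) ∷ []) ∷ snoc us (n ∘ there)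
    shared : ∀ {x} → x ≡ σ c ⊎ x ∈ flat r → x ∈ flat D ⊎ x ∈ y ∷ [] → x ≡ σ c
    shared (inj₁ e) _                  = e
    shared (inj₂ i) (inj₁ j)           = contradiction j (∥-flat (proj₂ (proj₂ rs)) i)
    shared (inj₂ i) (inj₂ (here refl)) = contradiction fixed (saturated-flat satʳ i)
    stem∈ : ∀ {x} → x ∈ flat D ++ y ∷ [] → x ∈ vertices W
    stem∈ {x} = subst (x ∈_) (sym (stemWalk-vertices p satD fixed e))
    contains : Meets (r ++ D) v ⊎ v ≡ y → _
    contains (inj₂ refl) = inj₂ (stem∈ (∈-++⁺ʳ (flat D) (here refl)))
    contains (inj₁ i) with Meets-++ r i
    ... | inj₁ j = inj₁ (blossom-vertices⁺ a q b (proj₁ rs) satʳ apart (inj₂ j))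
    ... | inj₂ j = inj₂ (stem∈ (∈-++⁺ˡ (∈-flat⁺ j)))

  -- This is what remains when both ends of a path run into the same unsaturated vertex `y`: the
  -- path closes to a blossom with base `y`, and the stem has length zero.
  stemless : ∀ {y h t r} → σ y ≡ y → Arc y h → Path h t r → Arc t (σ y) → Regular r → All Saturated r →
             ∀ {v} → Meets r v ⊎ v ≡ y → Σ[ F ∈ Flower M ] Flower.Contains F v
  stemless {y} {r = r} fixed a p b reg sat m = record
    { blossom = blossom a p b reg sat apart
    ; isBase = blossom-base a p b reg sat apart
    ; end-unsaturated = fixed⇒unsaturated S valid fixed
    ; stem = ε ; stem-path = [] ∷ [] ; stem-alt = [] ; stem-even = divides 0 refl
    ; onlyBaseShared = λ { _ (here e) → e } }
    , inj₁ (blossom-vertices⁺ a p b reg sat apart (swap m))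
    where
    apart : ∀ {x} → x ∈ r → Apart y x
    apart x∈ = Apart-sym ((λ { refl → All.lookup sat x∈ fixed }) ,
                          (λ e → All.lookup sat x∈ (trans (cong σ e) (trans (σσ y) (trans (sym fixed) (sym e))))))

-- Maximality, and the vertices of flowers and T-posies

module _ {n : ℕ} {G : Graph n} where
  open Structure

  -- Every vertex saturated under `S` stays so under `S′`; one more would make the matching of `S′`
  -- larger than a maximum one.
  no-improvement : ∀ (S S′ : Structure G) (valid : Valid S) (valid′ : Valid S′) →
                   Maximum G (toMatching S valid) → (∀ {x} → σ S′ x ≡ x → σ S x ≡ x) →
                   ∀ {y} → σ S y ≡ y → σ S′ y ≡ y
  no-improvement S S′ valid valid′ max f {y} e with σ S′ y ≟ y
  ... | yes e′ = e′
  ... | no ne  = contradiction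
    (<-≤-trans (size-strict (toMatching S valid) (toMatching S′ valid′)
        (λ u → fixed⇒unsaturated S valid (f (unsaturated⇒fixed S′ valid′ u)))
        (fixed⇒unsaturated S valid e) (Mem⁺ S′ valid′ refl (≢-sym ne)))
      (max (toMatching S′ valid′)))
    (<-irrefl refl)

  module Join (S : Structure G) {y y′ : Fin n} (fixed : σ S y ≡ y) (fixed′ : σ S y′ ≡ y′) (y≢y′ : y ≢ y′) where

    σ⁺ : Fin n → Fin n
    σ⁺ x with x ≟ y | x ≟ y′
    ... | yes _ | _     = y′
    ... | no _  | yes _ = y
    ... | no _  | no _  = σ S x

    σ⁺-y : σ⁺ y ≡ y′
    σ⁺-y with y ≟ y
    ... | yes _ = refl
    ... | no ne = contradiction refl ne

    σ⁺-y′ : σ⁺ y′ ≡ y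
    σ⁺-y′ with y′ ≟ y | y′ ≟ y′
    ... | yes e | _     = e
    ... | no _  | yes _ = refl
    ... | no _  | no ne = contradiction refl ne

    σ⁺-other : ∀ {x} → x ≢ y → x ≢ y′ → σ⁺ x ≡ σ S x
    σ⁺-other {x} p q with x ≟ y | x ≟ y′
    ... | yes e | _     = contradiction e p
    ... | no _  | yes e = contradiction e q
    ... | no _  | no _  = refl

    σ⁺σ⁺ : ∀ x → σ⁺ (σ⁺ x) ≡ x
    σ⁺σ⁺ x with x ≟ y | x ≟ y′
    ... | yes refl | _        = σ⁺-y′
    ... | no _     | yes refl = σ⁺-y
    ... | no p     | no q     = trans
      (σ⁺-other (λ e → p (trans (sym (σσ S x)) (trans (cong (σ S) e) fixed)))
                (λ e → q (trans (sym (σσ S x)) (trans (cong (σ S) e) fixed′)))) (σσ S x)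

    joined : Structure G
    joined = record { edgeList = edgeList S ; E-sym = E-sym S ; E⇒Adj = E⇒Adj S ; σ = σ⁺ ; σσ = σ⁺σ⁺ }

    σ⁺-fixed : ∀ {x} → σ⁺ x ≡ x → σ S x ≡ x
    σ⁺-fixed {x} e with x ≟ y | x ≟ y′
    ... | yes refl | _        = fixed
    ... | no _     | yes refl = fixed′
    ... | no _     | no _     = e

  module Optimal (S : Structure G) (valid : Valid S) (max : Maximum G (toMatching S valid)) where
    open Digraph S
    open Caps S
    open Search S
    open Realize S valid

    unsaturated-nonadjacent : ∀ {y y′} → σ S y ≡ y → σ S y′ ≡ y′ → ¬ E S y y′
    unsaturated-nonadjacent {y} {y′} fixed fixed′ e = y≢y′ (trans
        (sym (no-improvement S joined valid valid⁺ max σ⁺-fixed fixed)) σ⁺-y)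
      where
      y≢y′ : y ≢ y′
      y≢y′ refl = E-irrefl S e
      open Join S fixed fixed′ y≢y′
      valid⁺ : Valid joined
      valid⁺ {x} ne with x ≟ y | x ≟ y′
      ... | yes refl | _        = e
      ... | no _     | yes refl = E-sym S e
      ... | no _     | no _     = valid ne

    -- Matching the two unsaturated ends to each other turns an augmenting path into an alternating
    -- cycle; switching along it removes the artificial edge again.
    no-augmenting-path : ∀ {c s D y y′} → Path c s D → Regular D → All Saturated D →
                         σ S y ≡ y → σ S y′ ≡ y′ → Arc y′ c → Arc s y → y ≡ y′
    no-augmenting-path {c} {s} {D} {y} {y′} p reg sat fixed fixed′ a b with y ≟ y′
    ... | yes e = e
    ... | no y≢y′ = contradiction (proj₁ (F.flip-fixed (no-improvement S F.flipped valid valid⁺ max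
              (σ⁺-fixed ∘ proj₂ ∘ F.flip-fixed) fixed)))
              λ off → proj₂ (off z≤n) (sym σ⁺-y′)
      where
      open Join S fixed fixed′ y≢y′
      module D⁺ = Digraph joined
      σ-same : ∀ {x} → Saturated x → σ⁺ x ≡ σ S x
      σ-same s = σ⁺-other (λ { refl → s fixed }) (λ { refl → s fixed′ })
      lift : ∀ {c s D} → Path c s D → All Saturated D → D⁺.Path c s D
      lift ⟨ x ⟩ _ = D⁺.⟨ x ⟩
      lift (_∷_ {y = w} a p) (_ ∷ ss) =
        (subst (E S _) (sym (σ-same (All.lookup ss (head∈ p)))) (proj₁ a) , proj₂ a) D⁺.∷ lift p ss
      lift-regular : ∀ {D} → Regular D → All Saturated D → D⁺.Regular D
      lift-regular []       []       = []
      lift-regular (r ∷ rs) (s ∷ ss) =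
        All.zipWith (λ (s′ , p , q) → p , λ e → q (trans e (σ-same s′))) (ss , r) ∷ lift-regular rs ss
      P : Caps.ClosedPath joined y′
      P = record
        { path = (subst (E S y′) (sym (σ-same (All.lookup sat (head∈ p)))) (proj₁ a) , proj₂ a) D⁺.∷ lift p sat
        -- Since `y` is now the mate of `y′`, the edge from `s` to `y` gives an arc to `y′`.
        ; closing = subst (E S s) (trans fixed (sym σ⁺-y′)) (proj₁ b) , λ { refl → All.lookup sat (last∈ p) fixed′ }
        ; regular = All.tabulate (λ x∈ → (λ { refl → All.lookup sat x∈ fixed′ }) ,
            λ e → let e′ = trans e (σ-same (All.lookup sat x∈)) in
              All.lookup sat x∈ (trans (sym e′) (trans (sym fixed′) (trans (cong (σ S) e′) (σσ S _)))))
            ∷ lift-regular reg sat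
        ; saturated = (λ e → y≢y′ (trans (sym σ⁺-y′) e)) ∷ All.map (λ s e → s (trans (sym (σ-same s)) e)) sat }
      Z = Cycles.fromClosedPath joined P
      module F = Flip joined Z
      valid⁺ : Valid F.flipped
      valid⁺ = F.flip-edge λ {x} off s →
        let same = σ⁺-other (λ e → proj₂ (off z≤n) (trans e (sym σ⁺-y′))) (proj₁ (off z≤n)) in
        subst (E S x) (sym same) (valid λ e → s (trans same e))

    -- Two loops make a T-posy and one makes a flower, after mirroring the path if the loop is at
    -- its far end. Two stops must coincide, as the path would be augmenting otherwise, and give a
    -- flower with a trivial stem.
    covered : ∀ (C : Config) {v} → Covers C v → V-T G v
    covered record { capˡ = loop a q b ; capʳ = loop a′ q′ b′ ; path = p
                   ; regularˡ = r₁ ; regularʳ = r₂ ; satˡ = s₁ ; satʳ = s₂ } (inj₁ m) =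
      inj₂ (M , max , tposy p a q b a′ q′ b′ r₁ r₂ s₁ s₂ m)
    covered record { capˡ = loop a q b ; capʳ = stop fixed e ; path = p
                   ; regularˡ = r₁ ; satˡ = s₁ } (inj₁ m) =
      inj₁ (M , max , flower p a q b fixed e r₁ s₁ (inj₁ m))
    covered record { capˡ = loop a q b ; capʳ = stop fixed e ; path = p
                   ; regularˡ = r₁ ; satˡ = s₁ } (inj₂ (stopsAt _ _)) =
      inj₁ (M , max , flower p a q b fixed e r₁ s₁ (inj₂ refl))
    covered record { c = c ; s = s ; D = D ; rʳ = rʳ ; capˡ = stop fixed e ; capʳ = loop {h} {t} a q b ; path = p
                   ; regularʳ = r₂ ; satˡ = s₁ ; satʳ = s₂ } (inj₁ m) =
      inj₁ (M , max , flower (Path-σ p) (subst (λ u → Arc u h) (sym (σσ S s)) a) q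
        (subst (λ u → Arc t (σ S u)) (sym (σσ S s)) b) fixed e
        (Regular-++⁺ (proj₁ rs) (Regular-revσ (proj₁ (proj₂ rs))) (∥-revσ (proj₂ (proj₂ rs))))
        (All.++⁺ s₂ (All-revσ Saturated-σ s₁))
        (inj₁ (Meets-++ʳ (Meets-revσ m))))
      where
      rs = Regular-++⁻ rʳ r₂
      Meets-++ʳ : ∀ {xs v} → Meets xs v → Meets (rʳ ++ xs) v
      Meets-++ʳ (inj₁ i) = inj₁ (∈-++⁺ʳ rʳ i)
      Meets-++ʳ (inj₂ i) = inj₂ (∈-++⁺ʳ rʳ i)
    covered record { c = c ; capˡ = stop {y′} fixed′ e′ ; capʳ = stop fixed e ; path = p
                   ; regularˡ = r₁ ; satˡ = s₁ } {v} m =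
      inj₁ (M , max , stemless fixed (subst (λ u → Arc u c) (sym same) back) p
        (subst (Arc _) (sym fixed) e) r₁ s₁ (cover m))
      where
      back : Arc y′ c
      back = subst₂ Arc fixed′ (σσ S c) (Arc-σ e′)
      same = no-augmenting-path p r₁ s₁ fixed fixed′ back e
      cover : (v ∈ _ ⊎ σ S v ∈ _) ⊎ StopsAt v (stop fixed e) → Meets _ v ⊎ v ≡ _
      cover (inj₁ m)             = inj₁ m
      cover (inj₂ (stopsAt _ _)) = inj₂ refl

  module _ (M : Matching G) (max : Maximum G M) where
    private S = fromMatching M

    still-maximum : ∀ S′ (valid : Valid S′) → (∀ {x} → σ S′ x ≡ x → σ S x ≡ x) →
                    Maximum G (toMatching S′ valid)
    still-maximum S′ valid f M′ = ≤-trans (max M′) (size-mono M (toMatching S′ valid)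
      λ u → σ⇒unsaturated M (f (unsaturated⇒fixed S′ valid u)))

    -- The last arc of the walk to `σ v` is kept apart to exclude the empty walk, which exists for
    -- every unsaturated `v`. For such `v` the vertex `u` is saturated, since unsaturated vertices
    -- are not adjacent.
    cyclic⇒V-T : ∀ {v u} → Star (Digraph.Arc S) v u → Digraph.Arc S u (σ S v) →
                 Star (Digraph.Arc S) (σ S v) v → V-T G v
    cyclic⇒V-T {v} {u} w a w′ with σ S v ≟ v
    ... | no sat = Optimal.covered S′ valid (still-maximum S′ valid fixed) config covers
      where open Solution (Resolve.solve S (<-wellFounded _) (fromMatching-valid M) sat (w ◅◅ a ◅ ε) w′)
    ... | yes fixed with σ S u ≟ u
    ...   | yes fixed′ = contradiction
      (subst (E S u) (trans (cong (σ S) fixed) fixed) (proj₁ a))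
      (Optimal.unsaturated-nonadjacent S (fromMatching-valid M)
        (still-maximum S (fromMatching-valid M) (λ e → e)) fixed′ fixed)
    ...   | no sat with Search.unsaturatedConfig S fixed sat w (subst (Digraph.Arc S u) fixed a)
    ...     | C , covers = Optimal.covered S (fromMatching-valid M)
                             (still-maximum S (fromMatching-valid M) (λ e → e)) C covers

-- J-flowers and J-posies

module Walks {n : ℕ} {G : Graph n} (M : Matching G) where
  open Graph G
  open Matching M
  open Structure (fromMatching M)
  open Digraph (fromMatching M)

  private S = fromMatching M

  inM? : ∀ e → Dec (InM M e)
  inM? (u , v) = T? (mem u v)

  count : List (Fin n × Fin n) → ℕ
  count es = length (filter inM? es)

  count-accept : ∀ {e es} → InM M e → count (e ∷ es) ≡ suc (count es)
  count-accept {es = es} m = cong length (filter-accept inM? {xs = es} m)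

  count-reject : ∀ {e es} → ¬ InM M e → count (e ∷ es) ≡ count es
  count-reject {es = es} m = cong length (filter-reject inM? {xs = es} m)

  count-++ : ∀ xs ys → count (xs ++ ys) ≡ count xs + count ys
  count-++ xs ys = trans (cong length (filter-++ inM? xs ys)) (length-++ (filter inM? xs))

  count-rotate : ∀ e f es → count (f ∷ es ++ e ∷ []) ≡ count (e ∷ f ∷ es)
  count-rotate e f es = trans (count-++ (f ∷ es) (e ∷ []))
    (trans (+-comm (count (f ∷ es)) (count (e ∷ []))) (sym (count-++ (e ∷ []) (f ∷ es))))

  -- An arc skips the vertex between its two edges, so a vertex of a walk in `G` may be present in
  -- the digraph walk only through its mate.
  Visits : Fin n → Fin n → Fin n → Set
  Visits x y z = (Star Arc x z × Star Arc z y) ⊎ (Star Arc x (σ z) × Star Arc (σ z) y)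

  visits-cons : ∀ {x x′ y z} → Arc x x′ → Visits x′ y z → Visits x y z
  visits-cons a (inj₁ (p , q)) = inj₁ (a ◅ p , q)
  visits-cons a (inj₂ (p , q)) = inj₂ (a ◅ p , q)

  visits-extend : ∀ {x x′ y y′ z} → Star Arc x x′ → Visits x′ y z → Star Arc y y′ → Visits x y′ z
  visits-extend a (inj₁ (p , q)) b = inj₁ (a ◅◅ p , q ◅◅ b)
  visits-extend a (inj₂ (p , q)) b = inj₂ (a ◅◅ p , q ◅◅ b)

  Traversal : ∀ {x y} → Fin n → Walk G x y → Set
  Traversal {x} {y} s w = Star Arc s y × (∀ {z} → z ∈ vertices w → Visits s y z)

  σ-unmatched : ∀ {x y} → Adj x y → ¬ Mem x y → Arc x (σ y)
  σ-unmatched {x} {y} a m = subst (E x) (sym (σσ y)) (E⁺ M a) , λ e → m (mem-sym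
    (subst (Mem y) (sym e) (σ⇒Mem M λ q → adj-irrefl (trans e q) a)))

  then∉ : ∀ {e f} → ExactlyOneInM M e f → InM M e → ¬ InM M f
  then∉ (inj₁ (_ , q)) _ = q
  then∉ (inj₂ (p , _)) m = contradiction m p

  then∈ : ∀ {e f} → ExactlyOneInM M e f → ¬ InM M e → InM M f
  then∈ (inj₁ (p , _)) m = contradiction p m
  then∈ (inj₂ (_ , q)) _ = q

  -- An unmatched edge and the matched edge after it form an arc; the first matched edge only moves
  -- the start from `x` to `σ x`. A last unmatched edge is an arc too, because its end is its own
  -- mate.
  alternating-traversal : ∀ {x y} (w : Walk G x y) → Alternating M w → AnyMaybe (InM M) (head (edges w)) →
                          AnyMaybe (InM M) (last (edges w)) ⊎ Unsaturated y → Traversal (σ x) w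
  alternating-traversal (e ◅ ε) _ (just m) _ with refl ← Mem⇒σ M m =
    ε , λ { (here refl) → inj₂ (ε , ε) ; (there (here refl)) → inj₁ (ε , ε) }
  alternating-traversal (e ◅ f ◅ ε) (r ∷ _) (just m) (inj₁ (just m′)) = contradiction m′ (then∉ r m)
  alternating-traversal {x} {y} (e ◅ f ◅ ε) (r ∷ _) (just m) (inj₂ u) with refl ← Mem⇒σ M m =
    a ◅ ε , λ { (here refl)                 → inj₂ (ε , a ◅ ε)
              ; (there (here refl))         → inj₁ (ε , a ◅ ε)
              ; (there (there (here refl))) → inj₁ (a ◅ ε , ε) }
    where
    a : Arc (σ x) y
    a = subst (Arc (σ x)) (unsaturated⇒σ M u) (σ-unmatched f (then∉ r m))
  alternating-traversal {x} {y} (e ◅ f ◅ w@(g ◅ _)) (r ∷ r′ ∷ alt) (just m) end with refl ← Mem⇒σ M m =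
    a ◅ proj₁ rest , λ { (here refl)         → inj₂ (ε , a ◅ proj₁ rest)
                       ; (there (here refl)) → inj₁ (ε , a ◅ proj₁ rest)
                       ; (there (there i))   → visits-cons a (proj₂ rest i) }
    where
    rest = alternating-traversal w alt (just (then∈ r′ (then∉ r m))) end
    a = σ-unmatched f (then∉ r m)

  -- If the first edge were unmatched, the last edge of an alternating walk of even length would be
  -- matched, but `y` is unsaturated.
  starts-matched : ∀ {x y} (w : Walk G x y) → Alternating M w → Unsaturated y → 2 ∣ ∥ w ∥ →
                   (x ≡ y × (∀ {z} → z ∈ vertices w → z ≡ x)) ⊎ AnyMaybe (InM M) (head (edges w))
  starts-matched ε _ _ _ = inj₁ (refl , λ { (here e) → e })
  starts-matched {x} w@(_◅_ {j = x′} e w′) alt u even with inM? (x , x′)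
  ... | yes m = inj₂ (just m)
  ... | no ¬m = contradiction even (odd e w′ alt u ¬m)
    where
    odd : ∀ {x x′ y} (e : Adj x x′) (w : Walk G x′ y) → Alternating M (e ◅ w) → Unsaturated y →
          ¬ Mem x x′ → 2 ∤ ∥ _◅_ {T = Adj} e w ∥
    odd e ε _ _ _ d = 1+n≰n (∣⇒≤ d)
    odd e (f ◅ ε) (r ∷ _) u ¬m _ = u _ (mem-sym (then∈ r ¬m))
    odd e (f ◅ g ◅ w) (r ∷ r′ ∷ alt) u ¬m d =
      odd g w alt u (then∉ r′ (then∈ r ¬m)) (∣m+n∣m⇒∣n d ∣-refl)

  -- Two consecutive edges of a path are never both matched, so each pair of edges contributes at
  -- most one.
  count-bound : ∀ {x y} (w : Walk G x y) → IsPath w → ∀ {k} → ∥ w ∥ ≤ 2 * k → count (edges w) ≤ k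
  count-bound ε _ _ = z≤n
  count-bound {x} (_◅_ {j = x′} e ε) _ {suc k} _ with inM? (x , x′)
  ... | yes m = ≤-trans (≤-reflexive (count-accept m)) (s≤s z≤n)
  ... | no ¬m = ≤-trans (≤-reflexive (count-reject ¬m)) z≤n
  count-bound {x} (_◅_ {j = x₁} e (_◅_ {j = x₂} f w)) ((_ ∷ u) ∷ _ ∷ us) {suc k} l
    with inM? (x , x₁) | inM? (x₁ , x₂)
       | count-bound w us (≤-pred (≤-pred (≤-trans l (≤-reflexive (double-suc k)))))
  ... | yes m | yes m′ | _ = contradiction (nonadjacent (mem-sym m) m′) (All.lookup u (start∈ w))
  ... | yes m | no ¬m′ | b = ≤-trans (≤-reflexive (trans (count-accept m) (cong suc (count-reject ¬m′)))) (s≤s b)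
  ... | no ¬m | yes m′ | b = ≤-trans (≤-reflexive (trans (count-reject ¬m) (count-accept m′))) (s≤s b)
  ... | no ¬m | no ¬m′ | b = ≤-trans (≤-reflexive (trans (count-reject ¬m) (count-reject ¬m′))) (≤-trans b (n≤1+n k))

  -- Two consecutive unmatched edges would leave too short a rest for the k matched edges.
  half-matched-traversal : ∀ {x y} k (w : Walk G x y) → IsPath w → ∥ w ∥ ≡ 2 * k → count (edges w) ≡ k →
                           (∀ {z} → z ∈ vertices w → ¬ Mem x z) → Traversal x w
  half-matched-traversal zero ε _ _ _ _ = ε , λ { (here refl) → inj₁ (ε , ε) }
  half-matched-traversal (suc k) ε _ () _ _
  half-matched-traversal (suc k) (e ◅ ε) _ l _ _ = contradiction (trans l (double-suc k)) λ ()
  half-matched-traversal {x} (suc k) (_◅_ {j = x₁} e (_◅_ {j = x₂} f w)) ((_ ∷ u) ∷ u₁ ∷ us) l c base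
    with inM? (x₁ , x₂)
  ... | no ¬m = contradiction
    (≤-trans (≤-reflexive (sym (trans (sym (trans (count-reject (base (there (here refl)))) (count-reject ¬m))) c)))
      (count-bound w us (≤-reflexive l′))) 1+n≰n
    where
    l′ : ∥ w ∥ ≡ 2 * k
    l′ = suc-injective (suc-injective (trans l (double-suc k)))
  ... | yes m with refl ← Mem⇒σ M m =
    a ◅ proj₁ rest , λ { (here refl)         → inj₁ (ε , a ◅ proj₁ rest)
                       ; (there (here refl)) → inj₂ (a ◅ ε , proj₁ rest)
                       ; (there (there i))   → visits-cons a (proj₂ rest i) }
    where
    l′ : ∥ w ∥ ≡ 2 * k
    l′ = suc-injective (suc-injective (trans l (double-suc k)))
    rest = half-matched-traversal k w us l′
      (suc-injective (trans (sym (trans (count-reject (base (there (here refl)))) (count-accept m))) c))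
      λ i m′ → All.lookup u₁ i (nonadjacent (mem-sym m) m′)
    a : Arc x (σ x₁)
    a = σ-unmatched e (base (there (here refl)))

  -- A cycle may be presented from any of its vertices, whereas a blossom has to be traversed from
  -- its base.
  record Rotation (V : List (Fin n)) (k : ℕ) (b : Fin n) : Set where
    field
      {end}   : Fin n
      path    : Walk G b end
      closing : Adj end b
      isPath  : IsPath path
      even    : ∥ path ∥ ≡ 2 * k
      half    : count ((end , b) ∷ edges path) ≡ k
      covers  : ∀ {v} → v ∈ V → v ∈ vertices path
      within  : ∀ {v} → v ∈ vertices path → v ∈ V

  snoc-vertices : ∀ {x y z} (w : Walk G x y) (c : Adj y z) → vertices (w ◅◅ c ◅ ε) ≡ vertices w ++ z ∷ []
  snoc-vertices ε       c = refl
  snoc-vertices (_ ◅ w) c = cong (_ ∷_) (snoc-vertices w c)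

  snoc-edges : ∀ {x y z} (w : Walk G x y) (c : Adj y z) → edges (w ◅◅ c ◅ ε) ≡ edges w ++ (y , z) ∷ []
  snoc-edges ε       c = refl
  snoc-edges (_ ◅ w) c = cong (_ ∷_) (snoc-edges w c)

  Unique-snoc : ∀ {x : Fin n} {xs} → All (x ≢_) xs → Unique xs → Unique (xs ++ x ∷ [])
  Unique-snoc []       []       = [] ∷ []
  Unique-snoc (p ∷ ps) (q ∷ qs) = All.++⁺ q (≢-sym p ∷ []) ∷ Unique-snoc ps qs

  rotate : ∀ {V k x b y} (w₁ : Walk G x b) (w₂ : Walk G b y) → Adj y x → IsPath (w₁ ◅◅ w₂) →
           ∥ w₁ ◅◅ w₂ ∥ ≡ 2 * k → count ((y , x) ∷ edges (w₁ ◅◅ w₂)) ≡ k →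
           (∀ {v} → v ∈ V → v ∈ vertices (w₁ ◅◅ w₂)) → (∀ {v} → v ∈ vertices (w₁ ◅◅ w₂) → v ∈ V) →
           Rotation V k b
  rotate ε w₂ c u l h p q = record
    { path = w₂ ; closing = c ; isPath = u ; even = l ; half = h ; covers = p ; within = q }
  rotate {V} {k} {x} {b} {y} (_◅_ {j = x₁} e w₁) w₂ c (a ∷ u) l h p q =
    rotate w₁ (w₂ ◅◅ c ◅ ε) e
      (subst Unique (sym vs) (Unique-snoc a u))
      (trans (cong length es) (trans (length-++ (edges w)) (trans (+-comm (length (edges w)) 1) l)))
      (trans (cong (λ l → count ((x , x₁) ∷ l)) es) (trans (count-rotate (y , x) (x , x₁) (edges w)) h))
      (λ i → subst (_ ∈_) (sym vs) (turn (p i)))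
      (λ i → q (turn⁻ (∈-++⁻ (vertices w) (subst (_ ∈_) vs i))))
    where
    w = w₁ ◅◅ w₂
    assoc = ◅◅-assoc w₁ w₂ (c ◅ ε)
    vs : vertices (w₁ ◅◅ w₂ ◅◅ c ◅ ε) ≡ vertices w ++ x ∷ []
    vs = trans (cong vertices (sym assoc)) (snoc-vertices w c)
    es : edges (w₁ ◅◅ w₂ ◅◅ c ◅ ε) ≡ edges w ++ (y , x) ∷ []
    es = trans (cong edges (sym assoc)) (snoc-edges w c)
    turn : ∀ {v} → v ∈ x ∷ vertices w → v ∈ vertices w ++ x ∷ []
    turn (here refl) = ∈-++⁺ʳ (vertices w) (here refl)
    turn (there i)   = ∈-++⁺ˡ i
    turn⁻ : ∀ {v} → v ∈ vertices w ⊎ v ∈ x ∷ [] → v ∈ x ∷ vertices w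
    turn⁻ (inj₁ i)           = there i
    turn⁻ (inj₂ (here refl)) = here refl

  cut : ∀ {x y b} (w : Walk G x y) → b ∈ vertices w → ∃₂ λ (w₁ : Walk G x b) (w₂ : Walk G b y) → w ≡ w₁ ◅◅ w₂
  cut ε       (here refl) = ε , ε , refl
  cut (e ◅ w) (here refl) = ε , e ◅ w , refl
  cut (e ◅ w) (there i) with cut w i
  ... | w₁ , w₂ , refl = e ◅ w₁ , w₂ , refl

  blossom-traversal : (B : Blossom M) → ∀ {b} → Blossom.IsBase B b →
                      (∃ λ u → Star Arc b u × Arc u (σ b)) × (∀ {z} → z ∈ Blossom.cycleVertices B → Visits b (σ b) z)
  blossom-traversal B {b} (b∈ , base) with cut (Blossom.path B) b∈
  ... | w₁ , w₂ , eq = (end , proj₁ trav , final) , λ z∈ → visits-extend ε (proj₂ trav (covers z∈)) (final ◅ ε)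
    where
    open Blossom B renaming (path to cyclePath; final to cycleFinal; closing to cycleClosing; isPath to cycleIsPath)
    rotation : Rotation cycleVertices k b
    rotation = rotate w₁ w₂ cycleClosing
      (subst IsPath eq cycleIsPath)
      (trans (cong ∥_∥ (sym eq)) (suc-injective oddLength))
      (trans (cong (λ w → count (_ ∷ edges w)) (sym eq)) kMatched)
      (λ {v} → subst (λ w → v ∈ vertices w) eq)
      (λ {v} → subst (λ w → v ∈ vertices w) (sym eq))
    open Rotation rotation
    unmatched : ¬ Mem end b
    unmatched m = base (within (end∈ path)) (mem-sym m)
    trav : Traversal b path
    trav = half-matched-traversal k path isPath even (trans (sym (count-reject unmatched)) half) (base ∘ within)
    final : Arc end (σ b)
    final = σ-unmatched closing unmatched

module _ {n : ℕ} {G : Graph n} (M : Matching G) (max : Maximum G M) where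
  open Walks M
  open Structure (fromMatching M)
  open Digraph (fromMatching M)

  unsnoc : ∀ {x u y z} → Star Arc x u → Arc u y → Star Arc y z → ∃ λ u′ → Star Arc x u′ × Arc u′ z
  unsnoc w a ε        = _ , w , a
  unsnoc w a (b ◅ w′) = unsnoc (w ◅◅ a ◅ ε) b w′

  module _ {b u : Fin n} (w : Star Arc b u) (a : Arc u (σ b)) (back : Star Arc (σ b) b) where

    -- From `x` to `b`, round to `σ b`, and on along the mirror image of the way from `x` to `b`:
    -- this reaches `σ x`. The mirror image of the way from `b` to `x`, then `back`, then that way
    -- itself lead from `σ x` to `x`.
    onLoop : ∀ {x} → Star Arc b x → Star Arc x b → V-T G x
    onLoop p q with unsnoc (q ◅◅ w) a (Star-σ q)
    ... | _ , w′ , a′ = cyclic⇒V-T M max w′ a′ (Star-σ p ◅◅ back ◅◅ p)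

    visited : ∀ {x} → Visits b b x → V-T G x
    visited (inj₁ (p , q)) = onLoop p q
    visited {x} (inj₂ (p , q)) = subst (V-T G) (σσ x) (onLoop (w ◅◅ a ◅ Star-σ q) (Star-σ p ◅◅ back))

  jflower⇒V-T : (F : Jflower M) → ∀ {v} → Jflower.Contains F v → V-T G v
  jflower⇒V-T F {v} m with blossom-traversal blossom isBase
                   | starts-matched walk walk-alt end-unsaturated walk-even
    where open Jflower F
  ... | (_ , w , a) , round | inj₁ (refl , trivial) = contained m
    where
    open Jflower F
    back : Star Arc (σ base) base
    back = subst (λ u → Star Arc u base) (sym (unsaturated⇒σ M end-unsaturated)) ε
    contained : Contains v → V-T G v
    contained (inj₁ i) = visited w a back (visits-extend ε (round i) back)
    contained (inj₂ i) = subst (V-T G) (sym (trivial i)) (onLoop w a back ε ε)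
  ... | (_ , w , a) , round | inj₂ m₁ = contained m
    where
    open Jflower F
    along = alternating-traversal walk walk-alt m₁ (inj₂ end-unsaturated)
    -- As `end` is its own mate, the mirror image of the walk begins where the walk ends.
    return : Star Arc end base
    return = subst₂ (Star Arc) (unsaturated⇒σ M end-unsaturated) (σσ base) (Star-σ (proj₁ along))
    back = proj₁ along ◅◅ return
    contained : Contains v → V-T G v
    contained (inj₁ i) = visited w a back (visits-extend ε (round i) back)
    contained (inj₂ i) = visited w a back (visits-extend (w ◅◅ a ◅ ε) (proj₂ along i) return)

  jposy⇒V-T : (P : Jposy M) → ∀ {v} → Jposy.Contains P v → V-T G v
  jposy⇒V-T P {v} m with blossom-traversal blossom₁ isBase₁ | blossom-traversal blossom₂ isBase₂
    where open Jposy P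
  ... | (_ , w₁ , a₁) , round₁ | (_ , w₂ , a₂) , round₂ = contained m
    where
    open Jposy P
    along = alternating-traversal walk (proj₁ walk-mm) (proj₁ (proj₂ walk-mm)) (inj₁ (proj₂ (proj₂ walk-mm)))
    return : Star Arc (σ base₂) base₁
    return = subst (Star Arc (σ base₂)) (σσ base₁) (Star-σ (proj₁ along))
    loop₁ = w₁ ◅◅ a₁ ◅ ε
    loop₂ = w₂ ◅◅ a₂ ◅ ε
    -- Along the walk to the second base, round the second blossom to the mate of that base, and
    -- home along the mirror image of the walk.
    back = proj₁ along ◅◅ loop₂ ◅◅ return
    contained : Contains v → V-T G v
    contained (inj₁ i)        = visited w₁ a₁ back (visits-extend ε (round₁ i) back)
    contained (inj₂ (inj₁ i)) = visited w₁ a₁ back (visits-extend (loop₁ ◅◅ proj₁ along) (round₂ i) return)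
    contained (inj₂ (inj₂ i)) = visited w₁ a₁ back (visits-extend loop₁ (proj₂ along i) (loop₂ ◅◅ return))

theorem7p1 : ∀ (n : ℕ) (G : Graph n) → (V-T G ≐ V-ESG G) × (V-ESG G ≐ V-J G)
theorem7p1 n G = (T⇒ESG , J⇒T ∘ ESG⇒J) , (ESG⇒J , T⇒ESG ∘ J⇒T)
  where
  T⇒ESG : V-T G ⊆ V-ESG G
  T⇒ESG (inj₁ f)                 = inj₁ f
  T⇒ESG (inj₂ (M , max , P , c)) = inj₂ (M , max , Tposy.posy P , c)

  ESG⇒J : V-ESG G ⊆ V-J G
  ESG⇒J (inj₁ (M , max , F , c)) = inj₁ (M , max , record
    { blossom = blossom ; isBase = isBase ; end-unsaturated = end-unsaturated
    ; walk = stem ; walk-alt = stem-alt ; walk-even = stem-even } , c)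
    where open Flower F
  ESG⇒J (inj₂ (M , max , P , c)) = inj₂ (M , max , record
    { blossom₁ = blossom₁ ; blossom₂ = blossom₂ ; isBase₁ = isBase₁ ; isBase₂ = isBase₂
    ; walk = path ; walk-mm = path-mm ; walk-odd = path-odd } , c)
    where open Posy P

  J⇒T : V-J G ⊆ V-T G
  J⇒T (inj₁ (M , max , F , c)) = jflower⇒V-T M max F c
  J⇒T (inj₂ (M , max , P , c)) = jposy⇒V-T M max P c
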